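{- Let $\mathbb{G}$ be a reduced graph of order $n$ and rank $r\geqslant 10$ with $n>m(r)$, and suppose $\mathbb{G}$ has the minimum possible order among all reduced graphs $G'$ of some rank $r'\geqslant 2$ with $|G'|>m(r')$. Let $\tau=\tau(\mathbb{G})$ and let $H$ be an induced subgraph of $\mathbb{G}$ of order $n-\tau$ which has duplicated vertices, and suppose $\mathrm{rank}(H)\geqslant r-3$. Let $\epsilon$ be the number of isolated vertices of $H$, and let $S$ be the induced subgraph of $\mathbb{G}$ on a set consisting of exactly one vertex from each duplication class of $H$. Then $\epsilon=0$ and one of the following holds: (i) $S$ is isomorphic to $K_1$ and $\tau\geqslant m(r-2)+2$; (ii) $S$ is isomorphic to $K_2$ and $\tau\geqslant m(r-2)+1$; (iii) $S$ is isomorphic to $K_3$ and $\tau=m(r-2)$.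
   Context: All graphs are finite and simple; $K_k$ is the complete graph on $k$ vertices. The rank of a graph is the rank over $\mathbb{R}$ of its adjacency matrix. A graph is reduced if it has no isolated vertices and no two distinct vertices with the same set of neighbors; two distinct vertices with the same neighborhood (in the graph under consideration) are duplicated vertices. A duplication class of a graph is a maximal set of at least two vertices all having the same neighborhood in that graph. For a non-complete graph $G$, $\tau(G)$ is the minimum number of vertices whose removal results in a graph having duplicated vertices. For integers $r$, $m(r)=2^{(r+2)/2}-2$ if $r$ is even and $m(r)=5\cdot 2^{(r-3)/2}-2$ if $r$ is odd. (The isomorphism type of $S$ does not depend on the choice of representatives.) -}

module Defs where

open import Data.Nat using (ℕ; zero; suc; _+_; _*_; _∸_; _^_; _≤_; _<_; _≡ᵇ_)
open import Data.Nat.DivMod using (_/_; _%_)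
open import Data.Bool using (Bool; true; false; if_then_else_)
open import Data.Fin using (Fin)
open import Data.Fin.Subset using (Subset; _∈_; ∣_∣; ⊤)
open import Data.Rational using (ℚ; 0ℚ; 1ℚ) renaming (_+_ to _+ℚ_; _*_ to _*ℚ_)
open import Data.Product using (Σ; ∃; _×_; _,_)
open import Relation.Binary.PropositionalEquality using (_≡_; _≢_)
open import Relation.Nullary using (¬_)

record Graph (n : ℕ) : Set where
  field
    adj    : Fin n → Fin n → Bool
    sym    : ∀ i j → adj i j ≡ adj j i
    irrefl : ∀ i → adj i i ≡ false
open Graph public

m : ℕ → ℕ
m r = if r % 2 ≡ᵇ 0 then 2 ^ ((r + 2) / 2) ∸ 2 else 5 * 2 ^ ((r ∸ 3) / 2) ∸ 2

Σℚ : (k : ℕ) → (Fin k → ℚ) → ℚ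
Σℚ zero    f = 0ℚ
Σℚ (suc k) f = f Fin.zero +ℚ Σℚ k (λ i → f (Fin.suc i))

-- adjacency matrix entry (real entries 0/1; we work over ℚ ⊆ ℝ,
-- the rank of a rational matrix is the same over ℚ and over ℝ)
A : ∀ {n} → Graph n → Fin n → Fin n → ℚ
A G i j = if adj G i j then 1ℚ else 0ℚ

IndepRows : ∀ {n} → Graph n → Subset n → (k : ℕ) → (Fin k → Fin n) → Set
IndepRows {n} G K k f =
  (c : Fin k → ℚ) →
  (∀ j → j ∈ K → Σℚ k (λ t → c t *ℚ A G (f t) j) ≡ 0ℚ) →
  ∀ t → c t ≡ 0ℚ

RankOn : ∀ {n} → Graph n → Subset n → ℕ → Set
RankOn {n} G K r =
  (Σ (Fin r → Fin n) λ f → (∀ t → f t ∈ K) × IndepRows G K r f)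
  × (∀ (f : Fin (suc r) → Fin n) → (∀ t → f t ∈ K) → ¬ IndepRows G K (suc r) f)

HasRank : ∀ {n} → Graph n → ℕ → Set
HasRank G r = RankOn G ⊤ r

SameNbhd : ∀ {n} → Graph n → Subset n → Fin n → Fin n → Set
SameNbhd G K u v = ∀ w → w ∈ K → adj G u w ≡ adj G v w

IsolatedIn : ∀ {n} → Graph n → Subset n → Fin n → Set
IsolatedIn G K u = ∀ w → w ∈ K → adj G u w ≡ false

DuplicatedIn : ∀ {n} → Graph n → Subset n → Fin n → Set
DuplicatedIn G K u = ∃ λ v → v ∈ K × u ≢ v × SameNbhd G K u v

HasDup : ∀ {n} → Graph n → Subset n → Set
HasDup G K = ∃ λ u → u ∈ K × DuplicatedIn G K u

Reduced : ∀ {n} → Graph n → Set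
Reduced {n} G =
  (∀ (i : Fin n) → ∃ λ j → adj G i j ≡ true)
  × (∀ (i j : Fin n) → (∀ k → adj G i k ≡ adj G j k) → i ≡ j)

-- τ(G) = t : the minimum number of vertices whose removal leaves a graph
-- with duplicated vertices. A removal is described by the kept set K,
-- the number of removed vertices is n ∸ ∣ K ∣.
IsTau : ∀ {n} → Graph n → ℕ → Set
IsTau {n} G t =
  (Σ (Subset n) λ K → n ∸ ∣ K ∣ ≡ t × HasDup G K)
  × (∀ (K : Subset n) → HasDup G K → t ≤ n ∸ ∣ K ∣)

Representatives : ∀ {n} → Graph n → Subset n → Subset n → Set
Representatives G K R =
  (∀ u → u ∈ R → u ∈ K × DuplicatedIn G K u)
  × (∀ u → u ∈ K → DuplicatedIn G K u → ∃ λ v → v ∈ R × SameNbhd G K u v)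
  × (∀ u v → u ∈ R → v ∈ R → SameNbhd G K u v → u ≡ v)

IsoComplete : ∀ {n} → Graph n → Subset n → ℕ → Set
IsoComplete G R k = ∣ R ∣ ≡ k × (∀ u v → u ∈ R → v ∈ R → u ≢ v → adj G u v ≡ true)

MinimalCounterexampleOrder : ℕ → Set
MinimalCounterexampleOrder n =
  ∀ (n' : ℕ) (G' : Graph n') (r' : ℕ) → 2 ≤ r' → Reduced G' → HasRank G' r' → m r' < n' → n ≤ n'

{-# OPTIONS --safe #-}
module Submission where

-- Write T for the set of removed vertices, N(v) for neighbourhoods, and regard the adjacency matrix as a
-- symmetric bilinear form. If u, v are twins in H then u - v is isotropic, vanishes on H and is ±1 on all of T,
-- by minimality of τ; since rank H ≥ r - 3, two such vectors are proportional. Hence T splits as N(u) ∪ N(v)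
-- in the same way for all twin pairs, and an isolated vertex of H is adjacent to all of T.
-- Let S consist of the twins on the u-side and the isolated vertex, if any. Differences of elements of S
-- vanish on T, and differences of elements of T on the same side vanish on S, so k independent differences
-- lower the rank of the other set by k. By minimality of the counterexample this bounds the order:
-- k independent differences in S give τ ≤ m(r - k), and k in one side of T give |S| ≤ m(r - 2 - k) + 1.
-- On the other hand τ + |S| ≥ m(r - 2) + 3, and more than 2^k distinct 0/1 rows have k + 1 independent
-- differences; playing these facts against each other forces |S| ≤ 3, and then S is a clique.

open import Defs renaming (sym to adj-sym)
open import Data.Nat using (ℕ; zero; suc; _+_; _*_; _∸_; _^_; _≤_; _<_; z≤n; s≤s)
import Data.Nat.Properties as ℕₚ
open import Data.Nat.DivMod using (m*n%n≡0; m*n/n≡m; [m+kn]%n≡m%n)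
open import Data.Nat.Solver using () renaming (module +-*-Solver to ℕ-Solver)
open import Data.Bool using (Bool; true; false; not)
import Data.Bool.Properties as Boolₚ
open import Data.Fin using (Fin; zero; suc; _↑ˡ_; _↑ʳ_; punchIn; punchOut)
import Data.Fin.Properties as Finₚ
open import Data.Fin.Subset using (Subset; _∈_; _∉_; ∣_∣; ⊤)
open import Data.Fin.Subset.Properties using (_∈?_; ∈⊤)
open import Data.Rational using (ℚ; 0ℚ; 1ℚ; 1/_; NonZero; ≢-nonZero) renaming (_+_ to _+ℚ_; _*_ to _*ℚ_; -_ to -ℚ_; _-_ to _-ℚ_)
import Data.Rational.Properties as ℚₚ
open import Data.Rational.Solver using () renaming (module +-*-Solver to ℚ-Solver)
open import Data.Vec using (tabulate; []; _∷_; lookup)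
open import Data.Vec.Properties using (lookup∘tabulate; lookup⇒[]=; []=⇒lookup)
open import Data.List using (List; []; _∷_; length)
open import Data.List.Membership.Propositional using () renaming (_∈_ to _∈ₗ_; _∉_ to _∉ₗ_)
import Data.List.Membership.DecPropositional as DecMembership
open import Data.List.Relation.Unary.Any using (here; there; index)
open import Data.List.Relation.Unary.Any.Properties using (lookup-index)
open import Data.List.Relation.Unary.All using (All; []; _∷_)
open import Data.List.Relation.Unary.AllPairs using (AllPairs; []; _∷_)
open import Data.Product using (Σ; ∃; _×_; _,_; proj₁; proj₂)
open import Data.Sum using (_⊎_; inj₁; inj₂; [_,_]′)
open import Data.Unit using (tt) renaming (⊤ to Unit)
open import Data.Empty using (⊥; ⊥-elim)
open import Function using (_∘_)
open import Function.Definitions using (Injective)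
open import Relation.Nullary using (¬_; yes; no; contradiction; Dec; does)
open import Relation.Nullary.Decidable using (decidable-stable; ¬?; _×-dec_; _⊎-dec_; _→-dec_; dec-true)
open import Relation.Unary using (Decidable)
open import Relation.Binary.PropositionalEquality using (_≡_; _≢_; refl; sym; trans; cong; cong₂; subst; subst₂; subst-injective; subst-sym-subst; module ≡-Reasoning)

open ℚ-Solver using (solve; _:=_; _:+_; _:*_; :-_; _:-_; con)
open ℕ-Solver using () renaming (solve to solveℕ; _:=_ to _≔_; _:+_ to _⊕_; _:*_ to _⊗_; con to #c)

-- Sums of rationals

-- Minimality speaks of reduced graphs only, and neither T nor S need be reduced. Fewer than τ
-- vertices of K are neither duplicated nor isolated (`K₁`), whereas two nonadjacent vertices differ
-- in at least τ places; hence S and each side of T are free of twins. T may still have an isolated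
-- vertex or twins across the sides. Dropping the twins on one side costs a factor of two, but the
-- same vertices supply an isotropic vector that lowers the rank by two more, and
-- `m (2 + a) ≡ 2 + 2 * m a` balances the loss exactly. Counting differences stops at |S| ≤ 4, since
-- four distinct rows guarantee only two independent differences. The rest is combinatorial:
-- nonadjacent vertices of S differ in at least τ vertices, all in K, so they agree on very few
-- vertices of K, while their twins force agreements. This makes S a clique, and four vertices of a
-- clique do have three independent differences. Rank is defined by the non-existence of larger
-- independent families, so spans and ranks of subgraphs are available only under double negation;
-- the bounds drawn from them are decidable.

Σ-cong : ∀ k {f g : Fin k → ℚ} → (∀ t → f t ≡ g t) → Σℚ k f ≡ Σℚ k g
Σ-cong zero    f≗g = refl
Σ-cong (suc k) f≗g = cong₂ _+ℚ_ (f≗g zero) (Σ-cong k (f≗g ∘ suc))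

Σ-zero : ∀ k {f : Fin k → ℚ} → (∀ t → f t ≡ 0ℚ) → Σℚ k f ≡ 0ℚ
Σ-zero zero    f≗0 = refl
Σ-zero (suc k) f≗0 = trans (cong₂ _+ℚ_ (f≗0 zero) (Σ-zero k (f≗0 ∘ suc))) (ℚₚ.+-identityˡ 0ℚ)

Σ-+ : ∀ k (f g : Fin k → ℚ) → Σℚ k (λ t → f t +ℚ g t) ≡ Σℚ k f +ℚ Σℚ k g
Σ-+ zero    f g = sym (ℚₚ.+-identityˡ 0ℚ)
Σ-+ (suc k) f g = trans (cong (f zero +ℚ g zero +ℚ_) (Σ-+ k (f ∘ suc) (g ∘ suc)))
  (solve 4 (λ a b c d → a :+ b :+ (c :+ d) := a :+ c :+ (b :+ d)) refl
    (f zero) (g zero) (Σℚ k (f ∘ suc)) (Σℚ k (g ∘ suc)))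

Σ-*ˡ : ∀ k a (f : Fin k → ℚ) → Σℚ k (λ t → a *ℚ f t) ≡ a *ℚ Σℚ k f
Σ-*ˡ zero    a f = sym (ℚₚ.*-zeroʳ a)
Σ-*ˡ (suc k) a f = trans (cong (a *ℚ f zero +ℚ_) (Σ-*ˡ k a (f ∘ suc))) (sym (ℚₚ.*-distribˡ-+ a _ _))

Σ-*ʳ : ∀ k a (f : Fin k → ℚ) → Σℚ k (λ t → f t *ℚ a) ≡ Σℚ k f *ℚ a
Σ-*ʳ k a f = trans (Σ-cong k (λ t → ℚₚ.*-comm (f t) a)) (trans (Σ-*ˡ k a f) (ℚₚ.*-comm a _))

Σ-swap : ∀ k l (f : Fin k → Fin l → ℚ) →
  Σℚ k (λ s → Σℚ l (f s)) ≡ Σℚ l (λ t → Σℚ k (λ s → f s t))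
Σ-swap zero    l f = sym (Σ-zero l (λ _ → refl))
Σ-swap (suc k) l f = trans (cong (Σℚ l (f zero) +ℚ_) (Σ-swap k l (f ∘ suc)))
  (sym (Σ-+ l (f zero) (λ t → Σℚ k (λ s → f (suc s) t))))

Σ-split : ∀ k d (f : Fin (k + d) → ℚ) →
  Σℚ (k + d) f ≡ Σℚ k (λ t → f (t ↑ˡ d)) +ℚ Σℚ d (λ t → f (k ↑ʳ t))
Σ-split zero    d f = sym (ℚₚ.+-identityˡ _)
Σ-split (suc k) d f = trans (cong (f zero +ℚ_) (Σ-split k d (f ∘ suc)))
  (sym (ℚₚ.+-assoc (f zero) (Σℚ k (λ t → f (suc (t ↑ˡ d)))) (Σℚ d (λ t → f (suc (k ↑ʳ t))))))

*-cancel-0 : ∀ {p q} → q ≢ 0ℚ → p *ℚ q ≡ 0ℚ → p ≡ 0ℚ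
*-cancel-0 {p} {q} q≢0 pq≡0 = begin
  p                      ≡⟨ sym (ℚₚ.*-identityʳ p) ⟩
  p *ℚ 1ℚ                ≡⟨ cong (p *ℚ_) (sym (ℚₚ.*-inverseʳ q)) ⟩
  p *ℚ (q *ℚ 1/ q)       ≡⟨ sym (ℚₚ.*-assoc p q _) ⟩
  p *ℚ q *ℚ 1/ q         ≡⟨ cong (_*ℚ 1/ q) pq≡0 ⟩
  0ℚ *ℚ 1/ q             ≡⟨ ℚₚ.*-zeroˡ (1/ q) ⟩
  0ℚ                     ∎
  where
  open ≡-Reasoning
  instance
    q-nonZero : NonZero q
    q-nonZero = ≢-nonZero q≢0

-- Dependence of r + 1 vectors in an r-dimensional space

-- Gaussian elimination: a nonzero entry of the first vector clears its column from the others,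
-- which then live in one dimension less. If the first vector is zero, it is a dependence by itself.
dependent : ∀ r (v : Fin (suc r) → Fin r → ℚ) →
  Σ (Fin (suc r) → ℚ) λ c → (∃ λ t → c t ≢ 0ℚ) × (∀ i → Σℚ (suc r) (λ t → c t *ℚ v t i) ≡ 0ℚ)
dependent zero v = (λ _ → 1ℚ) , (zero , λ ()) , λ ()
dependent (suc r) v with Finₚ.any? (λ j → ¬? (v zero j ℚₚ.≟ 0ℚ))
... | no v₀≡0 = c , (zero , λ ()) , λ i →
  trans (cong₂ _+ℚ_ (trans (ℚₚ.*-identityˡ _) (decidable-stable (v zero i ℚₚ.≟ 0ℚ) (λ p → v₀≡0 (i , p))))
                    (Σ-zero (suc r) (λ t → ℚₚ.*-zeroˡ (v (suc t) i))))
        (ℚₚ.+-identityˡ 0ℚ)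
  where
  c : Fin (suc (suc r)) → ℚ
  c zero    = 1ℚ
  c (suc _) = 0ℚ
... | yes (j , vj≢0) = c , (suc (proj₁ (proj₁ (proj₂ ih))) , proj₂ (proj₁ (proj₂ ih))) , kills
  where
  instance
    pivot-nonZero : NonZero (v zero j)
    pivot-nonZero = ≢-nonZero vj≢0
  ρ : Fin (suc r) → ℚ
  ρ t = v (suc t) j *ℚ 1/ v zero j
  w : Fin (suc r) → Fin (suc r) → ℚ
  w t i = v (suc t) i -ℚ ρ t *ℚ v zero i
  ih = dependent r (λ t i → w t (punchIn j i))
  c′ = proj₁ ih
  c : Fin (suc (suc r)) → ℚ
  c zero    = -ℚ Σℚ (suc r) (λ t → c′ t *ℚ ρ t)
  c (suc t) = c′ t
  wj≡0 : ∀ t → w t j ≡ 0ℚ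
  wj≡0 t = begin
    v (suc t) j -ℚ v (suc t) j *ℚ 1/ v zero j *ℚ v zero j
      ≡⟨ cong (λ x → v (suc t) j -ℚ x) (trans (ℚₚ.*-assoc (v (suc t) j) _ _)
           (trans (cong (v (suc t) j *ℚ_) (ℚₚ.*-inverseˡ (v zero j))) (ℚₚ.*-identityʳ _))) ⟩
    v (suc t) j -ℚ v (suc t) j
      ≡⟨ ℚₚ.+-inverseʳ (v (suc t) j) ⟩
    0ℚ ∎
    where open ≡-Reasoning
  w-kills : ∀ i → Σℚ (suc r) (λ t → c′ t *ℚ w t i) ≡ 0ℚ
  w-kills i with j Finₚ.≟ i
  ... | yes refl = Σ-zero (suc r) (λ t → trans (cong (c′ t *ℚ_) (wj≡0 t)) (ℚₚ.*-zeroʳ (c′ t)))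
  ... | no j≢i   = subst (λ i → Σℚ (suc r) (λ t → c′ t *ℚ w t i) ≡ 0ℚ) (Finₚ.punchIn-punchOut j≢i)
                     (proj₂ (proj₂ ih) (punchOut j≢i))
  kills : ∀ i → c zero *ℚ v zero i +ℚ Σℚ (suc r) (λ t → c′ t *ℚ v (suc t) i) ≡ 0ℚ
  kills i = begin
    c zero *ℚ v zero i +ℚ Σℚ (suc r) (λ t → c′ t *ℚ v (suc t) i)
      ≡⟨ cong (c zero *ℚ v zero i +ℚ_) (trans
           (Σ-cong (suc r) (λ t → solve 4 (λ a b c d → a :* b := a :* (b :- c :* d) :+ a :* c :* d) refl
              (c′ t) (v (suc t) i) (ρ t) (v zero i)))
           (Σ-+ (suc r) (λ t → c′ t *ℚ w t i) (λ t → c′ t *ℚ ρ t *ℚ v zero i))) ⟩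
    c zero *ℚ v zero i +ℚ (Σℚ (suc r) (λ t → c′ t *ℚ w t i) +ℚ Σℚ (suc r) (λ t → c′ t *ℚ ρ t *ℚ v zero i))
      ≡⟨ cong₂ (λ a b → c zero *ℚ v zero i +ℚ (a +ℚ b)) (w-kills i)
           (Σ-*ʳ (suc r) (v zero i) (λ t → c′ t *ℚ ρ t)) ⟩
    c zero *ℚ v zero i +ℚ (0ℚ +ℚ Σℚ (suc r) (λ t → c′ t *ℚ ρ t) *ℚ v zero i)
      ≡⟨ solve 2 (λ a b → (:- a) :* b :+ (con 0ℚ :+ a :* b) := con 0ℚ) refl
           (Σℚ (suc r) (λ t → c′ t *ℚ ρ t)) (v zero i) ⟩
    0ℚ ∎
    where open ≡-Reasoning

-- Linear independence of families of row vectors on a set of columns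

IndepOn : ∀ {n k} → (Fin n → Set) → (Fin k → Fin n → ℚ) → Set
IndepOn {n} {k} Y g = (c : Fin k → ℚ) →
  (∀ j → Y j → Σℚ k (λ t → c t *ℚ g t j) ≡ 0ℚ) → ∀ t → c t ≡ 0ℚ

Everywhere : ∀ {n} → Fin n → Set
Everywhere _ = Unit

infixr 5 _◂_ _⧺_

_◂_ : ∀ {A : Set} {k} → A → (Fin k → A) → Fin (suc k) → A
(x ◂ g) zero    = x
(x ◂ g) (suc t) = g t

_⧺_ : ∀ {A : Set} {k d} → (Fin k → A) → (Fin d → A) → Fin (k + d) → A
_⧺_ {k = zero}  g h         = h
_⧺_ {k = suc k} g h zero    = g zero
_⧺_ {k = suc k} g h (suc t) = ((g ∘ suc) ⧺ h) t

∅ : ∀ {A : Set} → Fin 0 → A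
∅ ()

⧺-ˡ : ∀ {A : Set} {k d} (g : Fin k → A) (h : Fin d → A) t → (g ⧺ h) (t ↑ˡ d) ≡ g t
⧺-ˡ g h zero    = refl
⧺-ˡ g h (suc t) = ⧺-ˡ (g ∘ suc) h t

⧺-ʳ : ∀ {A : Set} {k d} (g : Fin k → A) (h : Fin d → A) t → (g ⧺ h) (k ↑ʳ t) ≡ h t
⧺-ʳ {k = zero}  g h t = refl
⧺-ʳ {k = suc k} g h t = ⧺-ʳ (g ∘ suc) h t

⧺-elim : ∀ k {d} (P : Fin (k + d) → Set) → (∀ t → P (t ↑ˡ d)) → (∀ t → P (k ↑ʳ t)) → ∀ t → P t
⧺-elim zero    P l r t       = r t
⧺-elim (suc k) P l r zero    = l zero
⧺-elim (suc k) P l r (suc t) = ⧺-elim k (P ∘ suc) (l ∘ suc) r t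

⧺-all : ∀ {A : Set} (P : A → Set) {k d} (g : Fin k → A) (h : Fin d → A) →
  (∀ t → P (g t)) → (∀ t → P (h t)) → ∀ t → P ((g ⧺ h) t)
⧺-all P {k} g h pg ph = ⧺-elim k (λ t → P ((g ⧺ h) t))
  (λ t → subst P (sym (⧺-ˡ g h t)) (pg t)) (λ t → subst P (sym (⧺-ʳ g h t)) (ph t))

indep-mono : ∀ {n k} {X Y : Fin n → Set} {g : Fin k → Fin n → ℚ} →
  (∀ j → X j → Y j) → IndepOn X g → IndepOn Y g
indep-mono X⊆Y ind c h = ind c (λ j x → h j (X⊆Y j x))

indep-tail : ∀ {n k} {Y : Fin n → Set} {g : Fin (suc k) → Fin n → ℚ} → IndepOn Y g → IndepOn Y (g ∘ suc)
indep-tail {g = g} ind c h t = ind (0ℚ ◂ c)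
  (λ j y → trans (cong₂ _+ℚ_ (ℚₚ.*-zeroˡ (g zero j)) (h j y)) (ℚₚ.+-identityˡ 0ℚ)) (suc t)

indep-∅ : ∀ {n} {Y : Fin n → Set} {g : Fin 0 → Fin n → ℚ} → IndepOn Y g
indep-∅ c h ()

-- Block triangularity: only `g` is visible on `X`, so its coefficients vanish first, and `h` is
-- then tested on `Y`.
indep-⧺ : ∀ {n k d} {B : Set} (ρ : B → Fin n → ℚ) {X Y : Fin n → Set} {g : Fin k → B} {h : Fin d → B} →
  (∀ j → X j → Y j) → IndepOn X (ρ ∘ g) → (∀ t j → X j → ρ (h t) j ≡ 0ℚ) → IndepOn Y (ρ ∘ h) →
  IndepOn Y (ρ ∘ (g ⧺ h))
indep-⧺ {k = k} {d} ρ {X} {Y} {g} {h} X⊆Y ig h0 ih c hyp = ⧺-elim k (λ t → c t ≡ 0ℚ) left right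
  where
  open ≡-Reasoning
  split : ∀ j → Σℚ (k + d) (λ t → c t *ℚ ρ ((g ⧺ h) t) j)
    ≡ Σℚ k (λ t → c (t ↑ˡ d) *ℚ ρ (g t) j) +ℚ Σℚ d (λ t → c (k ↑ʳ t) *ℚ ρ (h t) j)
  split j = trans (Σ-split k d _) (cong₂ _+ℚ_
    (Σ-cong k (λ t → cong (λ x → c (t ↑ˡ d) *ℚ ρ x j) (⧺-ˡ g h t)))
    (Σ-cong d (λ t → cong (λ x → c (k ↑ʳ t) *ℚ ρ x j) (⧺-ʳ g h t))))
  left : ∀ t → c (t ↑ˡ d) ≡ 0ℚ
  left = ig (λ t → c (t ↑ˡ d)) λ j x → begin
    Σℚ k (λ t → c (t ↑ˡ d) *ℚ ρ (g t) j)
      ≡⟨ sym (ℚₚ.+-identityʳ _) ⟩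
    Σℚ k (λ t → c (t ↑ˡ d) *ℚ ρ (g t) j) +ℚ 0ℚ
      ≡⟨ cong (Σℚ k (λ t → c (t ↑ˡ d) *ℚ ρ (g t) j) +ℚ_) (sym (Σ-zero d (λ t →
           trans (cong (c (k ↑ʳ t) *ℚ_) (h0 t j x)) (ℚₚ.*-zeroʳ (c (k ↑ʳ t)))))) ⟩
    Σℚ k (λ t → c (t ↑ˡ d) *ℚ ρ (g t) j) +ℚ Σℚ d (λ t → c (k ↑ʳ t) *ℚ ρ (h t) j)
      ≡⟨ trans (sym (split j)) (hyp j (X⊆Y j x)) ⟩
    0ℚ ∎
  right : ∀ t → c (k ↑ʳ t) ≡ 0ℚ
  right = ih (λ t → c (k ↑ʳ t)) λ j y → begin
    Σℚ d (λ t → c (k ↑ʳ t) *ℚ ρ (h t) j)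
      ≡⟨ sym (ℚₚ.+-identityˡ _) ⟩
    0ℚ +ℚ Σℚ d (λ t → c (k ↑ʳ t) *ℚ ρ (h t) j)
      ≡⟨ cong (_+ℚ Σℚ d (λ t → c (k ↑ʳ t) *ℚ ρ (h t) j)) (sym (Σ-zero k (λ t →
           trans (cong (_*ℚ ρ (g t) j) (left t)) (ℚₚ.*-zeroˡ (ρ (g t) j))))) ⟩
    Σℚ k (λ t → c (t ↑ˡ d) *ℚ ρ (g t) j) +ℚ Σℚ d (λ t → c (k ↑ʳ t) *ℚ ρ (h t) j)
      ≡⟨ trans (sym (split j)) (hyp j y) ⟩
    0ℚ ∎

-- Formal differences of vertices, read both as combinations of rows (row) and as functionals on row vectors (ev)

data Term (n : ℕ) : Set where
  ι   : Fin n → Term n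
  _⊖_ : Term n → Term n → Term n

infixl 6 _⊖_

Supp : ∀ {n} → (Fin n → Set) → Term n → Set
Supp Y (ι v)   = Y v
Supp Y (a ⊖ b) = Supp Y a × Supp Y b

ev : ∀ {n} → Term n → (Fin n → ℚ) → ℚ
ev (ι v)   φ = φ v
ev (a ⊖ b) φ = ev a φ -ℚ ev b φ

supp-everywhere : ∀ {n} (a : Term n) → Supp Everywhere a
supp-everywhere (ι v)   = tt
supp-everywhere (a ⊖ b) = supp-everywhere a , supp-everywhere b

ev-vanish : ∀ {n} {Y : Fin n → Set} (a : Term n) {φ} → Supp Y a → (∀ j → Y j → φ j ≡ 0ℚ) → ev a φ ≡ 0ℚ
ev-vanish (ι v)   y         φ0 = φ0 v y
ev-vanish (a ⊖ b) (sa , sb) φ0 = cong₂ _-ℚ_ (ev-vanish a sa φ0) (ev-vanish b sb φ0)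

ev-Σ : ∀ {n} (a : Term n) k (c : Fin k → ℚ) (g : Fin k → Fin n → ℚ) →
  ev a (λ j → Σℚ k (λ t → c t *ℚ g t j)) ≡ Σℚ k (λ t → c t *ℚ ev a (g t))
ev-Σ (ι v)   k c g = refl
ev-Σ (a ⊖ b) k c g = begin
  ev a (λ j → Σℚ k (λ t → c t *ℚ g t j)) -ℚ ev b (λ j → Σℚ k (λ t → c t *ℚ g t j))
    ≡⟨ cong₂ _-ℚ_ (ev-Σ a k c g) (ev-Σ b k c g) ⟩
  Σℚ k (λ t → c t *ℚ ev a (g t)) -ℚ Σℚ k (λ t → c t *ℚ ev b (g t))
    ≡⟨ solve 2 (λ x y → x :- y := x :+ con (-ℚ 1ℚ) :* y) refl (Σℚ k (λ t → c t *ℚ ev a (g t))) (Σℚ k (λ t → c t *ℚ ev b (g t))) ⟩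
  Σℚ k (λ t → c t *ℚ ev a (g t)) +ℚ -ℚ 1ℚ *ℚ Σℚ k (λ t → c t *ℚ ev b (g t))
    ≡⟨ cong (Σℚ k (λ t → c t *ℚ ev a (g t)) +ℚ_) (sym (Σ-*ˡ k (-ℚ 1ℚ) (λ t → c t *ℚ ev b (g t)))) ⟩
  Σℚ k (λ t → c t *ℚ ev a (g t)) +ℚ Σℚ k (λ t → -ℚ 1ℚ *ℚ (c t *ℚ ev b (g t)))
    ≡⟨ sym (Σ-+ k (λ t → c t *ℚ ev a (g t)) (λ t → -ℚ 1ℚ *ℚ (c t *ℚ ev b (g t)))) ⟩
  Σℚ k (λ t → c t *ℚ ev a (g t) +ℚ -ℚ 1ℚ *ℚ (c t *ℚ ev b (g t)))
    ≡⟨ Σ-cong k (λ t → solve 3 (λ c x y → c :* x :+ con (-ℚ 1ℚ) :* (c :* y) := c :* (x :- y)) refl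
         (c t) (ev a (g t)) (ev b (g t))) ⟩
  Σℚ k (λ t → c t *ℚ (ev a (g t) -ℚ ev b (g t))) ∎
  where open ≡-Reasoning

-- Applying the functional `a` to a vanishing combination isolates the coefficient of `φ`. The
-- support of `a` lies in `Y` because the combination is known to vanish only there.
indep-◂ : ∀ {n k} {Y : Fin n → Set} {φ : Fin n → ℚ} {g : Fin k → Fin n → ℚ} (a : Term n) → Supp Y a →
  ev a φ ≢ 0ℚ → (∀ t → ev a (g t) ≡ 0ℚ) → IndepOn Y g → IndepOn Y (φ ◂ g)
indep-◂ {k = k} {Y} {φ} {g} a sa aφ≢0 ag≡0 ig c hyp = coeffs
  where
  open ≡-Reasoning
  c₀≡0 : c zero ≡ 0ℚ
  c₀≡0 = *-cancel-0 aφ≢0 (begin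
    c zero *ℚ ev a φ
      ≡⟨ sym (ℚₚ.+-identityʳ _) ⟩
    c zero *ℚ ev a φ +ℚ 0ℚ
      ≡⟨ cong (c zero *ℚ ev a φ +ℚ_) (sym (Σ-zero k (λ t →
           trans (cong (c (suc t) *ℚ_) (ag≡0 t)) (ℚₚ.*-zeroʳ (c (suc t)))))) ⟩
    Σℚ (suc k) (λ t → c t *ℚ ev a ((φ ◂ g) t))
      ≡⟨ sym (ev-Σ a (suc k) c (φ ◂ g)) ⟩
    ev a (λ j → Σℚ (suc k) (λ t → c t *ℚ (φ ◂ g) t j))
      ≡⟨ ev-vanish a sa hyp ⟩
    0ℚ ∎)
  coeffs : ∀ t → c t ≡ 0ℚ
  coeffs zero    = c₀≡0
  coeffs (suc t) = ig (c ∘ suc) (λ j y → begin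
    Σℚ k (λ t → c (suc t) *ℚ g t j)
      ≡⟨ sym (ℚₚ.+-identityˡ _) ⟩
    0ℚ +ℚ Σℚ k (λ t → c (suc t) *ℚ g t j)
      ≡⟨ cong (_+ℚ Σℚ k (λ t → c (suc t) *ℚ g t j)) (sym (trans (cong (_*ℚ φ j) c₀≡0) (ℚₚ.*-zeroˡ (φ j)))) ⟩
    c zero *ℚ φ j +ℚ Σℚ k (λ t → c (suc t) *ℚ g t j)
      ≡⟨ hyp j y ⟩
    0ℚ ∎) t

indep-single : ∀ {n} {Y : Fin n → Set} {φ : Fin n → ℚ} j → Y j → φ j ≢ 0ℚ → IndepOn Y (φ ◂ ∅)
indep-single j y φj≢0 = indep-◂ {g = ∅} (ι j) y φj≢0 (λ ()) (indep-∅ {g = ∅})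

-- The adjacency matrix as a bilinear form, and bounds on rank

module _ {n} (G : Graph n) where

  row : Term n → Fin n → ℚ
  row (ι v)   j = A G v j
  row (a ⊖ b) j = row a j -ℚ row b j

  A-sym : ∀ i j → A G i j ≡ A G j i
  A-sym i j rewrite adj-sym G i j = refl

  private
    row-ev : ∀ b u → row b u ≡ ev b (A G u)
    row-ev (ι v)   u = A-sym v u
    row-ev (a ⊖ b) u = cong₂ _-ℚ_ (row-ev a u) (row-ev b u)

    ev-⊖ : ∀ c a b → ev c (row (a ⊖ b)) ≡ ev c (row a) -ℚ ev c (row b)
    ev-⊖ (ι v)   a b = refl
    ev-⊖ (c ⊖ d) a b = trans (cong₂ _-ℚ_ (ev-⊖ c a b) (ev-⊖ d a b))
      (solve 4 (λ x y z w → x :- y :- (z :- w) := x :- z :- (y :- w)) refl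
        (ev c (row a)) (ev c (row b)) (ev d (row a)) (ev d (row b)))

  -- `ev a (row b)` is the value of the bilinear form at `a` and `b`. Its symmetry lets a vector
  -- that vanishes on a set serve as a functional killing the rows of that set.
  ev-sym : ∀ a b → ev a (row b) ≡ ev b (row a)
  ev-sym (ι u)   b = row-ev b u
  ev-sym (a ⊖ c) b = trans (cong₂ _-ℚ_ (ev-sym a b) (ev-sym c b)) (sym (ev-⊖ b a c))

  VanishesOn : (Fin n → Set) → Term n → Set
  VanishesOn X a = ∀ j → X j → row a j ≡ 0ℚ

  ev-vanishes : ∀ {X} a b → Supp X a → VanishesOn X b → ev a (row b) ≡ 0ℚ
  ev-vanishes a b = ev-vanish a

  vanishes-ev : ∀ {X} a b → VanishesOn X a → Supp X b → ev a (row b) ≡ 0ℚ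
  vanishes-ev a b va sb = trans (ev-sym a b) (ev-vanish b sb va)

  module _ {r} (rank : HasRank G r) where

    private
      f = proj₁ (proj₁ rank)

      F : Fin r → Fin n → ℚ
      F t = A G (f t)

      InSpan : (Fin n → ℚ) → Set
      InSpan φ = Σ (Fin r → ℚ) λ y → ∀ j → φ j ≡ Σℚ r (λ t → y t *ℚ F t j)

      -- Expressing a row through `f` needs an explicit dependence, and `HasRank` offers only a
      -- refutation of independence; hence the double negation.
      row-inSpan : ∀ v → ¬ ¬ InSpan (A G v)
      row-inSpan v ¬span = proj₂ rank (v ◂ f) (λ _ → ∈⊤) indep
        where
        indep : IndepRows G ⊤ (suc r) (v ◂ f)
        indep c hyp with c zero ℚₚ.≟ 0ℚ
        ... | yes c₀≡0 = λ { zero → c₀≡0 ; (suc t) → proj₂ (proj₂ (proj₁ rank)) (c ∘ suc)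
                (λ j _ → trans (sym (trans (cong (_+ℚ Σℚ r (λ t → c (suc t) *ℚ F t j))
                     (trans (cong (_*ℚ A G v j) c₀≡0) (ℚₚ.*-zeroˡ (A G v j)))) (ℚₚ.+-identityˡ _))) (hyp j ∈⊤)) t }
        ... | no c₀≢0 = ⊥-elim (¬span ((λ t → -ℚ (1/ c zero *ℚ c (suc t))) , span))
          where
          instance
            c₀-nonZero : NonZero (c zero)
            c₀-nonZero = ≢-nonZero c₀≢0
          open ≡-Reasoning
          span : ∀ j → A G v j ≡ Σℚ r (λ t → -ℚ (1/ c zero *ℚ c (suc t)) *ℚ F t j)
          span j = begin
            A G v j
              ≡⟨ sym (ℚₚ.*-identityˡ _) ⟩
            1ℚ *ℚ A G v j
              ≡⟨ cong (_*ℚ A G v j) (sym (ℚₚ.*-inverseˡ (c zero))) ⟩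
            1/ c zero *ℚ c zero *ℚ A G v j
              ≡⟨ solve 4 (λ i a b s → i :* a :* b := i :* (a :* b :+ s) :+ (:- i) :* s) refl
                   (1/ c zero) (c zero) (A G v j) (Σℚ r (λ t → c (suc t) *ℚ F t j)) ⟩
            1/ c zero *ℚ (c zero *ℚ A G v j +ℚ Σℚ r (λ t → c (suc t) *ℚ F t j))
              +ℚ -ℚ (1/ c zero) *ℚ Σℚ r (λ t → c (suc t) *ℚ F t j)
              ≡⟨ cong₂ (λ a b → 1/ c zero *ℚ a +ℚ b) (hyp j ∈⊤) (sym (Σ-*ˡ r (-ℚ (1/ c zero)) _)) ⟩
            1/ c zero *ℚ 0ℚ +ℚ Σℚ r (λ t → -ℚ (1/ c zero) *ℚ (c (suc t) *ℚ F t j))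
              ≡⟨ cong (_+ℚ Σℚ r (λ t → -ℚ (1/ c zero) *ℚ (c (suc t) *ℚ F t j))) (ℚₚ.*-zeroʳ (1/ c zero)) ⟩
            0ℚ +ℚ Σℚ r (λ t → -ℚ (1/ c zero) *ℚ (c (suc t) *ℚ F t j))
              ≡⟨ ℚₚ.+-identityˡ _ ⟩
            Σℚ r (λ t → -ℚ (1/ c zero) *ℚ (c (suc t) *ℚ F t j))
              ≡⟨ Σ-cong r (λ t → solve 3 (λ i c f → (:- i) :* (c :* f) := (:- (i :* c)) :* f) refl
                   (1/ c zero) (c (suc t)) (F t j)) ⟩
            Σℚ r (λ t → -ℚ (1/ c zero *ℚ c (suc t)) *ℚ F t j) ∎

      ¬¬-all : ∀ {N} {P : Fin N → Set} → (∀ i → ¬ ¬ P i) → ¬ ¬ (∀ i → P i)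
      ¬¬-all {zero}  ¬¬p ¬all = ¬all λ ()
      ¬¬-all {suc N} ¬¬p ¬all = ¬¬p zero λ p₀ → ¬¬-all (¬¬p ∘ suc) λ ps →
        ¬all λ { zero → p₀ ; (suc i) → ps i }

      term-inSpan : (∀ v → InSpan (A G v)) → ∀ a → InSpan (row a)
      term-inSpan rows (ι v)   = rows v
      term-inSpan rows (a ⊖ b) = (λ t → y t -ℚ y′ t) , λ j → begin
        row a j -ℚ row b j
          ≡⟨ cong₂ _-ℚ_ (proj₂ (term-inSpan rows a) j) (proj₂ (term-inSpan rows b) j) ⟩
        Σℚ r (λ t → y t *ℚ F t j) -ℚ Σℚ r (λ t → y′ t *ℚ F t j)
          ≡⟨ solve 2 (λ x y → x :- y := x :+ con (-ℚ 1ℚ) :* y) refl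
               (Σℚ r (λ t → y t *ℚ F t j)) (Σℚ r (λ t → y′ t *ℚ F t j)) ⟩
        Σℚ r (λ t → y t *ℚ F t j) +ℚ -ℚ 1ℚ *ℚ Σℚ r (λ t → y′ t *ℚ F t j)
          ≡⟨ cong (Σℚ r (λ t → y t *ℚ F t j) +ℚ_) (sym (Σ-*ˡ r (-ℚ 1ℚ) _)) ⟩
        Σℚ r (λ t → y t *ℚ F t j) +ℚ Σℚ r (λ t → -ℚ 1ℚ *ℚ (y′ t *ℚ F t j))
          ≡⟨ sym (Σ-+ r _ _) ⟩
        Σℚ r (λ t → y t *ℚ F t j +ℚ -ℚ 1ℚ *ℚ (y′ t *ℚ F t j))
          ≡⟨ Σ-cong r (λ t → solve 3 (λ x y f → x :* f :+ con (-ℚ 1ℚ) :* (y :* f) := (x :- y) :* f) refl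
               (y t) (y′ t) (F t j)) ⟩
        Σℚ r (λ t → (y t -ℚ y′ t) *ℚ F t j) ∎
        where
        open ≡-Reasoning
        y  = proj₁ (term-inSpan rows a)
        y′ = proj₁ (term-inSpan rows b)

      span-dependent : (g : Fin (suc r) → Fin n → ℚ) → (∀ t → InSpan (g t)) → ¬ IndepOn Everywhere g
      span-dependent g spans ind with dependent r (λ t → proj₁ (spans t))
      ... | c , (t , ct≢0) , kills = ct≢0 (ind c (λ j _ → begin
        Σℚ (suc r) (λ t → c t *ℚ g t j)
          ≡⟨ Σ-cong (suc r) (λ t → trans (cong (c t *ℚ_) (proj₂ (spans t) j)) (sym (Σ-*ˡ r (c t) _))) ⟩
        Σℚ (suc r) (λ t → Σℚ r (λ i → c t *ℚ (proj₁ (spans t) i *ℚ F i j)))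
          ≡⟨ Σ-swap (suc r) r (λ t i → c t *ℚ (proj₁ (spans t) i *ℚ F i j)) ⟩
        Σℚ r (λ i → Σℚ (suc r) (λ t → c t *ℚ (proj₁ (spans t) i *ℚ F i j)))
          ≡⟨ Σ-zero r (λ i → trans (Σ-cong (suc r) (λ t → sym (ℚₚ.*-assoc (c t) (proj₁ (spans t) i) (F i j))))
               (trans (Σ-*ʳ (suc r) (F i j) (λ t → c t *ℚ proj₁ (spans t) i))
                 (trans (cong (_*ℚ F i j) (kills i)) (ℚₚ.*-zeroˡ (F i j))))) ⟩
        0ℚ ∎) t)
        where open ≡-Reasoning

      drop-heads : ∀ d (g : Fin (d + suc r) → Term n) → (∀ v → InSpan (A G v)) →
        ¬ IndepOn Everywhere (row ∘ g)
      drop-heads zero    g rows ind = span-dependent (row ∘ g) (term-inSpan rows ∘ g) ind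
      drop-heads (suc d) g rows ind = drop-heads d (g ∘ suc) rows (indep-tail {g = row ∘ g} ind)

    -- `HasRank` bounds only families of rows of single vertices; differences are reached through
    -- spans. The finitely many double negations are combined, which suffices because `k ≤ r` is
    -- decidable.
    indep⇒≤rank : ∀ {k} (g : Fin k → Term n) → IndepOn Everywhere (row ∘ g) → k ≤ r
    indep⇒≤rank {k} g ind = decidable-stable (k ℕₚ.≤? r) λ k≰r →
      ¬¬-all row-inSpan λ rows → excess rows (ℕₚ.m∸n+n≡m (ℕₚ.≰⇒> k≰r)) g ind
      where
      excess : (∀ v → InSpan (A G v)) → ∀ {d} → d + suc r ≡ k → (g : Fin k → Term n) →
        ¬ IndepOn Everywhere (row ∘ g)
      excess rows {d} refl g ind = drop-heads d g rows ind

    rank-drop₀ : ∀ {X k d} (x : Fin k → Fin n) → IndepOn X (A G ∘ x) →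
      (f : Fin d → Term n) → (∀ t → VanishesOn X (f t)) → IndepOn Everywhere (row ∘ f) → k ≤ r ∸ d
    rank-drop₀ {k = k} x ix f f0 if = ℕₚ.m+n≤o⇒m≤o∸n k
      (indep⇒≤rank ((ι ∘ x) ⧺ f) (indep-⧺ row {g = ι ∘ x} (λ _ _ → tt) ix f0 if))

    -- b contributes an extra dimension because a, being orthogonal to everything else, detects its coefficient.
    rank-drop₁ : ∀ {X k d} (x : Fin k → Fin n) → (∀ t → X (x t)) → IndepOn X (A G ∘ x) →
      (f : Fin d → Term n) → (∀ t → VanishesOn X (f t)) → IndepOn Everywhere (row ∘ f) →
      (a b : Term n) → VanishesOn X a → (∀ t → ev a (row (f t)) ≡ 0ℚ) → ev a (row b) ≢ 0ℚ → k ≤ r ∸ suc d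
    rank-drop₁ {k = k} {d} x x∈X ix f f0 if a b a0 af≡0 ab≢0 = ℕₚ.m+n≤o⇒m≤o∸n k (subst (_≤ r) (sym (ℕₚ.+-suc k d))
      (indep⇒≤rank (b ◂ ((ι ∘ x) ⧺ f)) (λ c hyp → indep-◂ {φ = row b} {g = row ∘ ((ι ∘ x) ⧺ f)} a (supp-everywhere a) ab≢0
        (⧺-all (λ s → ev a (row s) ≡ 0ℚ) (ι ∘ x) f (λ t → vanishes-ev a (ι (x t)) a0 (x∈X t)) af≡0)
        (indep-⧺ row {g = ι ∘ x} (λ _ _ → tt) ix f0 if) c (λ j u → hyp j u))))

-- Cardinality of decidable sets of vertices

private
  tick : {X : Set} → Dec X → ℕ → ℕ
  tick (yes _) k = suc k
  tick (no _)  k = k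

# : ∀ {n} {P : Fin n → Set} → Decidable P → ℕ
# {zero}  P? = 0
# {suc n} P? = tick (P? zero) (# (P? ∘ suc))

#-compl : ∀ {n} {P : Fin n → Set} (P? : Decidable P) → # P? + # (¬? ∘ P?) ≡ n

#-compl {zero}  P? = refl
#-compl {suc n} P? with P? zero
... | yes _ = cong suc (#-compl (P? ∘ suc))
... | no _  = trans (ℕₚ.+-suc _ _) (cong suc (#-compl (P? ∘ suc)))

#-∪-≤ : ∀ {n} {P Q R : Fin n → Set} (P? : Decidable P) (Q? : Decidable Q) (R? : Decidable R) →
  (∀ i → R i → P i ⊎ Q i) → # R? ≤ # P? + # Q?
#-∪-≤ {zero}  P? Q? R? R⊆ = z≤n
#-∪-≤ {suc n} P? Q? R? R⊆ with R? zero | P? zero | Q? zero | #-∪-≤ (P? ∘ suc) (Q? ∘ suc) (R? ∘ suc) (R⊆ ∘ suc)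
... | yes r | no ¬p | no ¬q | _  = ⊥-elim (case (R⊆ zero r))
  where
  case : _ ⊎ _ → ⊥
  case (inj₁ p) = ¬p p
  case (inj₂ q) = ¬q q
... | yes _ | yes _ | yes _ | ih = s≤s (ℕₚ.≤-trans ih (ℕₚ.+-monoʳ-≤ (# (P? ∘ suc)) (ℕₚ.n≤1+n _)))
... | yes _ | yes _ | no _  | ih = s≤s ih
... | yes _ | no _  | yes _ | ih = ℕₚ.≤-trans (s≤s ih) (ℕₚ.≤-reflexive (sym (ℕₚ.+-suc _ _)))
... | no _  | yes _ | yes _ | ih = ℕₚ.m≤n⇒m≤1+n (ℕₚ.≤-trans ih (ℕₚ.+-monoʳ-≤ (# (P? ∘ suc)) (ℕₚ.n≤1+n _)))
... | no _  | yes _ | no _  | ih = ℕₚ.m≤n⇒m≤1+n ih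
... | no _  | no _  | yes _ | ih = ℕₚ.≤-trans ih (ℕₚ.+-monoʳ-≤ (# (P? ∘ suc)) (ℕₚ.n≤1+n _))
... | no _  | no _  | no _  | ih = ih

#-disjoint-≤ : ∀ {n} {P Q R : Fin n → Set} (P? : Decidable P) (Q? : Decidable Q) (R? : Decidable R) →
  (∀ i → P i → R i) → (∀ i → Q i → R i) → (∀ i → P i → ¬ Q i) → # P? + # Q? ≤ # R?
#-disjoint-≤ {zero}  P? Q? R? P⊆ Q⊆ disj = z≤n
#-disjoint-≤ {suc n} P? Q? R? P⊆ Q⊆ disj
  with P? zero | Q? zero | R? zero | #-disjoint-≤ (P? ∘ suc) (Q? ∘ suc) (R? ∘ suc) (P⊆ ∘ suc) (Q⊆ ∘ suc) (disj ∘ suc)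
... | yes p | yes q | _     | _  = ⊥-elim (disj zero p q)
... | yes p | no _  | no ¬r | _  = ⊥-elim (¬r (P⊆ zero p))
... | no _  | yes q | no ¬r | _  = ⊥-elim (¬r (Q⊆ zero q))
... | yes _ | no _  | yes _ | ih = s≤s ih
... | no _  | yes _ | yes _ | ih = ℕₚ.≤-trans (ℕₚ.≤-reflexive (ℕₚ.+-suc _ _)) (s≤s ih)
... | no _  | no _  | yes _ | ih = ℕₚ.m≤n⇒m≤1+n ih
... | no _  | no _  | no _  | ih = ih

enum : ∀ {n} {P : Fin n → Set} (P? : Decidable P) → Fin (# P?) → Fin n
enum {suc n} P? i with P? zero
enum {suc n} P? zero    | yes _ = zero
enum {suc n} P? (suc i) | yes _ = suc (enum (P? ∘ suc) i)
enum {suc n} P? i       | no _  = suc (enum (P? ∘ suc) i)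

enum-∈ : ∀ {n} {P : Fin n → Set} (P? : Decidable P) i → P (enum P? i)
enum-∈ {suc n} P? i with P? zero
enum-∈ {suc n} P? zero    | yes p = p
enum-∈ {suc n} P? (suc i) | yes _ = enum-∈ (P? ∘ suc) i
enum-∈ {suc n} P? i       | no _  = enum-∈ (P? ∘ suc) i

enum-injective : ∀ {n} {P : Fin n → Set} (P? : Decidable P) → Injective _≡_ _≡_ (enum P?)
enum-injective {suc n} P? {i} {j} eq with P? zero
enum-injective {suc n} P? {zero}  {zero}  eq | yes _ = refl
enum-injective {suc n} P? {suc i} {suc j} eq | yes _ = cong suc (enum-injective (P? ∘ suc) (Finₚ.suc-injective eq))
enum-injective {suc n} P? {i}     {j}     eq | no _  = enum-injective (P? ∘ suc) (Finₚ.suc-injective eq)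

enum-surjective : ∀ {n} {P : Fin n → Set} (P? : Decidable P) j → P j → ∃ λ i → enum P? i ≡ j
enum-surjective {suc n} P? j pj with P? zero
enum-surjective {suc n} P? zero    pj | yes _ = zero , refl
enum-surjective {suc n} P? (suc j) pj | yes _ with i , eq ← enum-surjective (P? ∘ suc) j pj = suc i , cong suc eq
enum-surjective {suc n} P? zero    pj | no ¬p = contradiction pj ¬p
enum-surjective {suc n} P? (suc j) pj | no _  with i , eq ← enum-surjective (P? ∘ suc) j pj = i , cong suc eq

#-inject : ∀ {n} {P Q : Fin n → Set} (P? : Decidable P) (Q? : Decidable Q) (f : ∀ i → P i → Fin n) →
  (∀ i p → Q (f i p)) → (∀ i p j q → f i p ≡ f j q → i ≡ j) → # P? ≤ # Q?
#-inject P? Q? f f∈Q f-inj = Finₚ.injective⇒≤ {f = g} g-inj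
  where
  x = λ i → f (enum P? i) (enum-∈ P? i)
  g : Fin (# P?) → Fin (# Q?)
  g i = proj₁ (enum-surjective Q? (x i) (f∈Q _ (enum-∈ P? i)))
  enum-g : ∀ i → enum Q? (g i) ≡ x i
  enum-g i = proj₂ (enum-surjective Q? (x i) (f∈Q _ (enum-∈ P? i)))
  g-inj : Injective _≡_ _≡_ g
  g-inj {i} {j} eq = enum-injective P? (f-inj _ _ _ _
    (trans (sym (enum-g i)) (trans (cong (enum Q?) eq) (enum-g j))))

#-mono : ∀ {n} {P Q : Fin n → Set} (P? : Decidable P) (Q? : Decidable Q) → (∀ i → P i → Q i) → # P? ≤ # Q?
#-mono P? Q? P⊆Q = #-inject P? Q? (λ i _ → i) P⊆Q (λ _ _ _ _ eq → eq)

#-≤1 : ∀ {n} {P : Fin n → Set} (P? : Decidable P) → (∀ i j → P i → P j → i ≡ j) → # P? ≤ 1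
#-≤1 P? unique = Finₚ.injective⇒≤ {n = 1} {f = λ _ → zero} λ {i} {j} _ →
  enum-injective P? (unique _ _ (enum-∈ P? i) (enum-∈ P? j))

module _ {n} {P : Fin n → Set} (P? : Decidable P) where

  open DecMembership (Finₚ._≟_ {n}) using () renaming (_∈?_ to _∈ₗ?_)

  Without : List (Fin n) → Fin n → Set
  Without xs i = P i × i ∉ₗ xs

  without? : ∀ xs → Decidable (Without xs)
  without? xs i = P? i ×-dec ¬? (i ∈ₗ? xs)

  #-≤length : ∀ xs → (∀ i → P i → i ∈ₗ xs) → # P? ≤ length xs
  #-≤length xs P⊆xs = Finₚ.injective⇒≤ {f = idx} λ {i} {j} eq → enum-injective P?
    (trans (sym (at i)) (trans (cong (Data.List.lookup xs) eq) (at j)))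
    where
    idx : Fin (# P?) → Fin (length xs)
    idx i = index (P⊆xs _ (enum-∈ P? i))
    at : ∀ i → Data.List.lookup xs (idx i) ≡ enum P? i
    at i = sym (lookup-index (P⊆xs _ (enum-∈ P? i)))

  pick : ∀ xs → length xs < # P? → ∃ λ a → P a × a ∉ₗ xs
  pick xs lt with Finₚ.any? (without? xs)
  ... | yes found = found
  ... | no none   = contradiction (#-≤length xs (λ i p → decidable-stable (i ∈ₗ? xs) (λ i∉ → none (i , p , i∉)))) (ℕₚ.<⇒≱ lt)

length≤# : ∀ {n} {P : Fin n → Set} (P? : Decidable P) (xs : List (Fin n)) → AllPairs _≢_ xs → All P xs → length xs ≤ # P?
length≤# P? []       _               _          = z≤n
length≤# P? (x ∷ xs) (x≢xs ∷ uniq) (px ∷ pxs) = ℕₚ.≤-trans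
  (ℕₚ.+-mono-≤ (Finₚ.injective⇒≤ {f = λ _ → proj₁ hit} λ { {zero} {zero} _ → refl }) (length≤# P∖x? xs uniq (rest x≢xs pxs)))
  (#-disjoint-≤ (x Finₚ.≟_) P∖x? P? (λ { i refl → px }) (λ i → proj₁) (λ { i refl (_ , x≢x) → x≢x refl }))
  where
  P∖x? = λ i → P? i ×-dec ¬? (x Finₚ.≟ i)
  hit = enum-surjective (x Finₚ.≟_) x refl
  rest : ∀ {ys} → All (x ≢_) ys → All _ ys → All (λ i → _ × x ≢ i) ys
  rest []         []       = []
  rest (ne ∷ nes) (p ∷ ps) = (p , ne) ∷ rest nes ps

#-∁-< : ∀ {n} {P : Fin n → Set} (P? : Decidable P) x → ¬ P x → # P? < n
#-∁-< P? x ¬px = ℕₚ.≤-trans (ℕₚ.≤-trans (ℕₚ.≤-reflexive (ℕₚ.+-comm 1 (# P?)))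
  (ℕₚ.+-monoʳ-≤ (# P?) (length≤# (¬? ∘ P?) (x ∷ []) ([] ∷ []) (¬px ∷ []))))
  (ℕₚ.≤-reflexive (#-compl P?))

toSubset : ∀ {n} {P : Fin n → Set} → Decidable P → Subset n
toSubset P? = tabulate (does ∘ P?)

∈-toSubset⁺ : ∀ {n} {P : Fin n → Set} (P? : Decidable P) {i} → P i → i ∈ toSubset P?
∈-toSubset⁺ P? {i} p = lookup⇒[]= i _ (trans (lookup∘tabulate _ i) (dec-true (P? i) p))

∈-toSubset⁻ : ∀ {n} {P : Fin n → Set} (P? : Decidable P) {i} → i ∈ toSubset P? → P i
∈-toSubset⁻ P? {i} i∈ with P? i | trans (sym (lookup∘tabulate (does ∘ P?) i)) ([]=⇒lookup i∈)
... | yes p | _ = p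
... | no _  | ()

∣toSubset∣ : ∀ {n} {P : Fin n → Set} (P? : Decidable P) → ∣ toSubset P? ∣ ≡ # P?
∣toSubset∣ {zero}  P? = refl
∣toSubset∣ {suc n} P? with P? zero
... | yes _ = cong suc (∣toSubset∣ (P? ∘ suc))
... | no _  = ∣toSubset∣ (P? ∘ suc)

#∈≡∣∣ : ∀ {n} (p : Subset n) → # (_∈? p) ≡ ∣ p ∣
#∈≡∣∣ p = trans (ℕₚ.≤-antisym
    (#-mono (_∈? p) (λ i → lookup p i Boolₚ.≟ true) (λ i → []=⇒lookup))
    (#-mono (λ i → lookup p i Boolₚ.≟ true) (_∈? p) (λ i → lookup⇒[]= i p)))
  (count p)
  where
  count : ∀ {n} (p : Subset n) → # (λ i → lookup p i Boolₚ.≟ true) ≡ ∣ p ∣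
  count []          = refl
  count (true ∷ p)  = cong suc (count p)
  count (false ∷ p) = count p

-- Arithmetic of the function m

m-even : ∀ k → m (k * 2) + 2 ≡ 2 ^ suc k
m-even k rewrite m*n%n≡0 k 2 {{_}} | ℕₚ.+-comm (k * 2) 2 | m*n/n≡m (suc k) 2 {{_}} =
  ℕₚ.m∸n+n≡m (ℕₚ.*-monoʳ-≤ 2 (ℕₚ.m^n>0 2 k))

m-odd : ∀ k → m (3 + k * 2) + 2 ≡ 5 * 2 ^ k
m-odd k rewrite [m+kn]%n≡m%n 3 k 2 {{_}} | m*n/n≡m k 2 {{_}} =
  ℕₚ.m∸n+n≡m (ℕₚ.≤-trans (s≤s (s≤s z≤n)) (ℕₚ.*-monoʳ-≤ 5 (ℕₚ.m^n>0 2 k)))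

parity : ∀ a → ∃ λ k → a ≡ k * 2 ⊎ a ≡ suc (k * 2)
parity zero    = 0 , inj₁ refl
parity (suc a) with parity a
... | k , inj₁ refl = k , inj₂ refl
... | k , inj₂ refl = suc k , inj₁ refl

≤-by : ∀ {a b} d → a + d ≡ b → a ≤ b
≤-by {a} d refl = ℕₚ.m≤m+n a d

parity₂ : ∀ {a} → 2 ≤ a → ∃ λ k → a ≡ suc k * 2 ⊎ a ≡ 3 + k * 2
parity₂ (s≤s (s≤s {n = a} _)) with parity a
... | k , inj₁ refl = k , inj₁ refl
... | k , inj₂ refl = k , inj₂ refl

m-step : ∀ {a} → 2 ≤ a → m (2 + a) ≡ 2 + 2 * m a
m-step 2≤a with parity₂ 2≤a
... | k , inj₁ refl = ℕₚ.+-cancelʳ-≡ 2 _ _ (trans (m-even (2 + k)) (trans (cong (2 *_) (sym (m-even (suc k))))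
        (solveℕ 1 (λ x → #c 2 ⊗ (x ⊕ #c 2) ≔ #c 2 ⊕ #c 2 ⊗ x ⊕ #c 2) refl (m (suc k * 2)))))
... | k , inj₂ refl = ℕₚ.+-cancelʳ-≡ 2 _ _ (trans (m-odd (suc k)) (trans
        (solveℕ 1 (λ x → #c 5 ⊗ (#c 2 ⊗ x) ≔ #c 2 ⊗ (#c 5 ⊗ x)) refl (2 ^ k)) (trans (cong (2 *_) (sym (m-odd k)))
        (solveℕ 1 (λ x → #c 2 ⊗ (x ⊕ #c 2) ≔ #c 2 ⊕ #c 2 ⊗ x ⊕ #c 2) refl (m (3 + k * 2))))))

m-step-∸ : ∀ {r φ} → 4 + φ ≤ r → 2 + 2 * m (r ∸ (2 + φ)) ≡ m (r ∸ φ)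
m-step-∸ {φ = φ} 4+φ≤r = trans (sym (m-step (ℕₚ.m+n≤o⇒m≤o∸n 2 4+φ≤r)))
  (cong m (sym (ℕₚ.+-∸-assoc 2 (ℕₚ.≤-trans (ℕₚ.m≤n+m (2 + φ) 2) 4+φ≤r))))

m-suc : ∀ {a} → 2 ≤ a → m a ≤ m (suc a)
m-suc 2≤a with parity₂ 2≤a
... | k , inj₁ refl = ℕₚ.+-cancelʳ-≤ 2 _ _ (subst₂ _≤_ (sym (m-even (suc k))) (sym (m-odd k))
        (≤-by (2 ^ k) (solveℕ 1 (λ x → #c 2 ⊗ (#c 2 ⊗ x) ⊕ x ≔ #c 5 ⊗ x) refl (2 ^ k))))
... | k , inj₂ refl = ℕₚ.+-cancelʳ-≤ 2 _ _ (subst₂ _≤_ (sym (m-odd k)) (sym (m-even (2 + k)))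
        (≤-by (3 * 2 ^ k) (solveℕ 1 (λ x → #c 5 ⊗ x ⊕ #c 3 ⊗ x ≔ #c 2 ⊗ (#c 2 ⊗ (#c 2 ⊗ x))) refl (2 ^ k))))

m-mono : ∀ {a b} → 2 ≤ a → a ≤ b → m a ≤ m b
m-mono {a} 2≤a a≤b = subst (λ b → m a ≤ m b) (ℕₚ.m∸n+n≡m a≤b) (climb (_ ∸ a))
  where
  climb : ∀ d → m a ≤ m (d + a)
  climb zero    = ℕₚ.≤-refl
  climb (suc d) = ℕₚ.≤-trans (climb d) (m-suc (ℕₚ.≤-trans 2≤a (ℕₚ.m≤n+m a d)))

-- From even `ρ` to its successor `m + 2` grows by the factor 5/4 exactly, from odd `ρ` by 8/5; the
-- second inequality is the bound 5/4 with the shift by 2 cleared. The first is an equality at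
-- `ρ = 6` and fails at `ρ = 4`.
m-gap : ∀ {ρ} → 5 ≤ ρ → (4 + m ρ ≤ m (suc ρ)) × (2 + 5 * m ρ ≤ 4 * m (suc ρ))
m-gap 5≤ρ with parity₂ (ℕₚ.≤-trans (s≤s (s≤s z≤n)) 5≤ρ)
m-gap (s≤s (s≤s ()))                         | zero , inj₁ refl
m-gap (s≤s (s≤s (s≤s (s≤s ()))))             | suc zero , inj₁ refl
m-gap _                                      | suc (suc j) , inj₁ refl = gap-even (ℕₚ.m^n>0 2 j) (m-even (3 + j)) (m-odd (2 + j))
  where
  gap-even : ∀ {y a b} → 0 < y → a + 2 ≡ 2 * (2 * (2 * (2 * y))) → b + 2 ≡ 5 * (2 * (2 * y)) →
    (4 + a ≤ b) × (2 + 5 * a ≤ 4 * b)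
  gap-even {suc y} {a} {b} _ ea eb =
    ℕₚ.+-cancelʳ-≤ 2 _ _ (subst₂ _≤_ (cong (4 +_) (sym ea)) (sym eb)
      (≤-by (4 * y) (solveℕ 1 (λ y → #c 4 ⊕ #c 2 ⊗ (#c 2 ⊗ (#c 2 ⊗ (#c 2 ⊗ (#c 1 ⊕ y)))) ⊕ #c 4 ⊗ y
        ≔ #c 5 ⊗ (#c 2 ⊗ (#c 2 ⊗ (#c 1 ⊕ y)))) refl y)))
    , ℕₚ.+-cancelʳ-≤ 8 _ _ (subst₂ _≤_
      (trans (cong (5 *_) (sym ea)) (solveℕ 1 (λ a → #c 5 ⊗ (a ⊕ #c 2) ≔ #c 2 ⊕ #c 5 ⊗ a ⊕ #c 8) refl a))
      (trans (cong (4 *_) (sym eb)) (solveℕ 1 (λ b → #c 4 ⊗ (b ⊕ #c 2) ≔ #c 4 ⊗ b ⊕ #c 8) refl b))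
      (ℕₚ.≤-reflexive (solveℕ 1 (λ y → #c 5 ⊗ (#c 2 ⊗ (#c 2 ⊗ (#c 2 ⊗ (#c 2 ⊗ y))))
        ≔ #c 4 ⊗ (#c 5 ⊗ (#c 2 ⊗ (#c 2 ⊗ y)))) refl (suc y))))
m-gap (s≤s (s≤s (s≤s ())))                   | zero , inj₂ refl
m-gap _                                      | suc j , inj₂ refl = gap-odd (ℕₚ.m^n>0 2 j) (m-odd (1 + j)) (m-even (3 + j))
  where
  gap-odd : ∀ {y a b} → 0 < y → a + 2 ≡ 5 * (2 * y) → b + 2 ≡ 2 * (2 * (2 * (2 * y))) →
    (4 + a ≤ b) × (2 + 5 * a ≤ 4 * b)
  gap-odd {suc y} {a} {b} _ ea eb =
    ℕₚ.+-cancelʳ-≤ 2 _ _ (subst₂ _≤_ (cong (4 +_) (sym ea)) (sym eb)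
      (≤-by (2 + 6 * y) (solveℕ 1 (λ y → #c 4 ⊕ #c 5 ⊗ (#c 2 ⊗ (#c 1 ⊕ y)) ⊕ (#c 2 ⊕ #c 6 ⊗ y)
        ≔ #c 2 ⊗ (#c 2 ⊗ (#c 2 ⊗ (#c 2 ⊗ (#c 1 ⊕ y))))) refl y)))
    , ℕₚ.+-cancelʳ-≤ 8 _ _ (subst₂ _≤_
      (trans (cong (5 *_) (sym ea)) (solveℕ 1 (λ a → #c 5 ⊗ (a ⊕ #c 2) ≔ #c 2 ⊕ #c 5 ⊗ a ⊕ #c 8) refl a))
      (trans (cong (4 *_) (sym eb)) (solveℕ 1 (λ b → #c 4 ⊗ (b ⊕ #c 2) ≔ #c 4 ⊗ b ⊕ #c 8) refl b))
      (≤-by (14 * suc y) (solveℕ 1 (λ y → #c 5 ⊗ (#c 5 ⊗ (#c 2 ⊗ y)) ⊕ #c 14 ⊗ y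
        ≔ #c 4 ⊗ (#c 2 ⊗ (#c 2 ⊗ (#c 2 ⊗ (#c 2 ⊗ y))))) refl (suc y))))

-- Induced subgraphs

module _ {n} (G : Graph n) where

  Same : (Fin n → Set) → Fin n → Fin n → Set
  Same X u v = ∀ w → X w → adj G u w ≡ adj G v w

  same? : ∀ {X : Fin n → Set} → Decidable X → ∀ u v → Dec (Same X u v)
  same? X? u v = Finₚ.all? (λ w → X? w →-dec (adj G u w Boolₚ.≟ adj G v w))

  Isolated : (Fin n → Set) → Fin n → Set
  Isolated X u = ∀ w → X w → adj G u w ≡ false

  isolated? : ∀ {X : Fin n → Set} → Decidable X → ∀ u → Dec (Isolated X u)
  isolated? X? u = Finₚ.all? (λ w → X? w →-dec (adj G u w Boolₚ.≟ false))

  NoTwins : (Fin n → Set) → Set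
  NoTwins X = ∀ u v → X u → X v → Same X u v → u ≡ v

  NoIsolated : (Fin n → Set) → Set
  NoIsolated X = ∀ u → X u → ¬ Isolated X u

  RankAtMost : (Fin n → Set) → ℕ → Set
  RankAtMost X ρ = ∀ k (x : Fin k → Fin n) → (∀ t → X (x t)) → IndepOn X (A G ∘ x) → k ≤ ρ

  rankAtMost-⊆ : ∀ {X Y : Fin n → Set} {ρ} → (∀ i → X i → Y i) → RankAtMost Y ρ → RankAtMost X ρ
  rankAtMost-⊆ X⊆Y rk k x x∈X ind = rk k x (λ t → X⊆Y _ (x∈X t)) (indep-mono {g = A G ∘ x} X⊆Y ind)

  A-true : ∀ {i j} → adj G i j ≡ true → A G i j ≡ 1ℚ
  A-true {i} {j} eq rewrite eq = refl

  A-false : ∀ {i j} → adj G i j ≡ false → A G i j ≡ 0ℚ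
  A-false {i} {j} eq rewrite eq = refl

  row-diff-0 : ∀ {a b j} → adj G a j ≡ adj G b j → row G (ι a ⊖ ι b) j ≡ 0ℚ
  row-diff-0 {a} {b} {j} eq rewrite eq with adj G b j
  ... | true  = refl
  ... | false = refl

  row-diff-≢0 : ∀ {a b j} → adj G a j ≢ adj G b j → row G (ι a ⊖ ι b) j ≢ 0ℚ
  row-diff-≢0 {a} {b} {j} ne with adj G a j | adj G b j
  ... | true  | true  = λ _ → ne refl
  ... | true  | false = λ ()
  ... | false | true  = λ ()
  ... | false | false = λ _ → ne refl

  A-≢0 : ∀ {i j} → adj G i j ≡ true → A G i j ≢ 0ℚ
  A-≢0 eq A≡0 with trans (sym (A-true eq)) A≡0
  ... | ()

  induced : ∀ {k} → (Fin k → Fin n) → Graph k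
  induced e = record
    { adj    = λ i j → adj G (e i) (e j)
    ; sym    = λ i j → adj-sym G (e i) (e j)
    ; irrefl = λ i → irrefl G (e i)
    }

  edge-indep : ∀ {i j} → adj G i j ≡ true → IndepRows G ⊤ 2 (i ◂ j ◂ ∅)
  edge-indep {i} {j} ij c hyp = coeffs
    where
    ind : IndepOn (_∈ ⊤) (A G i ◂ A G j ◂ ∅)
    ind = indep-◂ {g = A G j ◂ ∅} (ι j) ∈⊤ (A-≢0 ij) (λ { zero → A-false (irrefl G j) })
            (indep-single {φ = A G j} i ∈⊤ (A-≢0 (trans (adj-sym G j i) ij)))
    coeffs : ∀ t → c t ≡ 0ℚ
    coeffs = ind c hyp

-- The bound on smaller induced subgraphs

-- `P` will be the existence of `k` independent rows in a subgraph, which is not decided here, so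
-- its last success is found only up to double negation.
maximum : ∀ (P : ℕ → Set) → P 0 → ∀ b → (∀ k → P k → k ≤ b) → ¬ ¬ (∃ λ k → P k × ¬ P (suc k))
maximum P p₀ b bounded none = climb (suc b) λ pb → ℕₚ.<-irrefl refl (bounded (suc b) pb)
  where
  climb : ∀ k → ¬ ¬ P k
  climb zero    ¬p = ¬p p₀
  climb (suc k) ¬p = climb k λ p → none (k , p , ¬p)

module _ {n} (G : Graph n) (minimal : MinimalCounterexampleOrder n) where

  -- The subgraph on a nonempty `X` is reduced and, having an edge, of rank `r′` at least 2, so
  -- minimality applies to it; moreover `r′ ≤ ρ`, and `m` is monotone from 2 on.
  order≤m : ∀ {X : Fin n → Set} (X? : Decidable X) {ρ} → # X? < n → NoTwins G X → NoIsolated G X →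
    RankAtMost G X ρ → # X? ≤ m ρ
  order≤m {X} X? {ρ} X<n noTwins noIso rk with # X? in N≡
  ... | zero  = z≤n
  ... | suc N = decidable-stable (suc N ℕₚ.≤? m ρ) λ N≰ →
    maximum P ((λ ()) , (λ c _ ())) ρ bound λ { (r′ , p , ¬p) →
      N≰ (ℕₚ.≤-trans (ℕₚ.≮⇒≥ λ mr<N → ℕₚ.<⇒≱ X<n (minimal (suc N) G′ r′ (two≤ r′ ¬p) reduced (rank p ¬p) mr<N))
                     (m-mono (two≤ r′ ¬p) (bound r′ p))) }
    where
    e : Fin (suc N) → Fin n
    e i = enum X? (subst Fin (sym N≡) i)
    e-∈ : ∀ i → X (e i)
    e-∈ i = enum-∈ X? _
    e-injective : ∀ i j → e i ≡ e j → i ≡ j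
    e-injective i j eq = subst-injective (sym N≡) (enum-injective X? eq)
    e-onto : ∀ j → X j → ∃ λ i → e i ≡ j
    e-onto j xj with i , eq ← enum-surjective X? j xj =
      subst Fin N≡ i , trans (cong (enum X?) (subst-sym-subst N≡)) eq
    G′ = induced G e
    P : ℕ → Set
    P k = Σ (Fin k → Fin (suc N)) λ f → IndepRows G′ ⊤ k f
    bound : ∀ k → P k → k ≤ ρ
    bound k (f , ind) = rk k (e ∘ f) (e-∈ ∘ f) (λ c hyp → ind c (λ j _ → hyp (e j) (e-∈ j)))
    neighbour : ∀ i → ∃ λ j → adj G′ i j ≡ true
    neighbour i with Finₚ.any? (λ j → adj G′ i j Boolₚ.≟ true)
    ... | yes found = found
    ... | no none   = ⊥-elim (noIso (e i) (e-∈ i) λ w xw → isolated w (e-onto w xw))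
      where
      isolated : ∀ w → (∃ λ j → e j ≡ w) → adj G (e i) w ≡ false
      isolated w (j , refl) = Boolₚ.¬-not (λ t → none (j , t))
    reduced : Reduced G′
    reduced = neighbour , λ i j same → e-injective i j (noTwins (e i) (e j) (e-∈ i) (e-∈ j)
      λ w xw → subst (λ w → adj G (e i) w ≡ adj G (e j) w) (proj₂ (e-onto w xw)) (same (proj₁ (e-onto w xw))))
    p₂ : P 2
    p₂ = (zero ◂ proj₁ (neighbour zero) ◂ ∅) , edge-indep G′ (proj₂ (neighbour zero))
    two≤ : ∀ r′ → ¬ P (suc r′) → 2 ≤ r′
    two≤ zero          ¬p = ⊥-elim (¬p (proj₁ p₂ ∘ suc , indep-tail {g = A G′ ∘ proj₁ p₂} (proj₂ p₂)))
    two≤ (suc zero)    ¬p = ⊥-elim (¬p p₂)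
    two≤ (suc (suc _)) ¬p = s≤s (s≤s z≤n)
    rank : ∀ {r′} → P r′ → ¬ P (suc r′) → HasRank G′ r′
    rank (f , ind) ¬p = (f , (λ _ → ∈⊤) , ind) , λ g _ ind′ → ¬p (g , ind′)

  -- Two isolated vertices would be twins, so there is at most one. Its column is zero on `X`:
  -- removing it creates no twins, and a vertex isolated afterwards would have been its twin.
  order≤1+m : ∀ {X : Fin n → Set} (X? : Decidable X) {ρ} → # X? < n → NoTwins G X →
    RankAtMost G X ρ → # X? ≤ suc (m ρ)
  order≤1+m {X} X? {ρ} X<n noTwins rk with Finₚ.any? (λ w → X? w ×-dec isolated? G X? w)
  ... | no none = ℕₚ.m≤n⇒m≤1+n (order≤m X? X<n noTwins (λ u xu iso → none (u , xu , iso)) rk)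
  ... | yes (w , xw , iso-w) = ℕₚ.≤-trans
    (#-∪-≤ (Finₚ._≟ w) X′? X? cover)
    (ℕₚ.+-mono-≤ (#-≤1 (Finₚ._≟ w) (λ { i j refl refl → refl }))
      (order≤m X′? (ℕₚ.≤-<-trans (#-mono X′? X? (λ i → proj₁)) X<n) noTwins′ noIso′ (rankAtMost-⊆ G (λ i → proj₁) rk)))
    where
    X′ : Fin n → Set
    X′ i = X i × i ≢ w
    X′? : Decidable X′
    X′? i = X? i ×-dec ¬? (i Finₚ.≟ w)
    cover : ∀ i → X i → i ≡ w ⊎ X′ i
    cover i xi with i Finₚ.≟ w
    ... | yes eq = inj₁ eq
    ... | no ne  = inj₂ (xi , ne)
    at-w : ∀ u → X u → adj G u w ≡ false
    at-w u xu = trans (adj-sym G u w) (iso-w u xu)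
    noTwins′ : NoTwins G X′
    noTwins′ u v (xu , _) (xv , _) same = noTwins u v xu xv ext
      where
      ext : Same G X u v
      ext k xk with k Finₚ.≟ w
      ... | yes refl = trans (at-w u xu) (sym (at-w v xv))
      ... | no ne    = same k (xk , ne)
    noIso′ : NoIsolated G X′
    noIso′ u (xu , u≢w) iso-u = u≢w (noTwins u w xu xw ext)
      where
      ext : Same G X u w
      ext k xk with k Finₚ.≟ w
      ... | yes refl = trans (at-w u xu) (sym (irrefl G w))
      ... | no ne    = trans (iso-u k (xk , ne)) (sym (iso-w k xk))

-- Independent differences of rows

module _ {n} (G : Graph n) where

  differ : ∀ {Y : Fin n → Set} (Y? : Decidable Y) {a b} → ¬ Same G Y a b → ∃ λ y → Y y × adj G a y ≢ adj G b y
  differ Y? {a} {b} ¬same with Finₚ.any? (λ y → Y? y ×-dec ¬? (adj G a y Boolₚ.≟ adj G b y))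
  ... | yes found = found
  ... | no none   = ⊥-elim (¬same λ w yw → decidable-stable (adj G a w Boolₚ.≟ adj G b w) (λ ne → none (w , yw , ne)))

  diff : Fin n × Fin n → Term n
  diff (a , b) = ι a ⊖ ι b

  IndepDiffs : (X Y : Fin n → Set) → ℕ → Set
  IndepDiffs X Y k = Σ (Fin k → Fin n × Fin n) λ g →
    (∀ t → X (proj₁ (g t)) × X (proj₂ (g t))) × IndepOn Y (row G ∘ diff ∘ g)

  -- Halve the set by a column on which it is not constant: the differences found in the larger half
  -- vanish in that column, so a difference across the two halves is independent of them.
  indepDiffs : ∀ f {X Y : Fin n → Set} (X? : Decidable X) (Y? : Decidable Y) →
    (∀ a b → X a → X b → Same G Y a b → a ≡ b) → 2 ^ f < # X? → IndepDiffs X Y (suc f)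
  indepDiffs f {X} {Y} X? Y? distinct big
    with a , xa , _   ← pick X? [] (ℕₚ.≤-<-trans z≤n big)
    with b , xb , b∉ ← pick X? (a ∷ []) (ℕₚ.≤-<-trans (ℕₚ.m^n>0 2 f) big)
    with y , yy , ne  ← differ Y? {a} {b} (λ same → b∉ (here (sym (distinct a b xa xb same))))
    = extend f big
    where
    extend : ∀ f → 2 ^ f < # X? → IndepDiffs X Y (suc f)
    extend zero    _   = ((a , b) ◂ ∅) , (λ { zero → xa , xb }) ,
      λ c hyp → indep-single {Y = Y} {φ = row G (ι a ⊖ ι b)} y yy (row-diff-≢0 G ne) c hyp
    extend (suc f) big = [ grow true , grow false ]′ half
      where
      X∣ : Bool → Fin n → Set
      X∣ β i = X i × adj G i y ≡ β
      X∣? : ∀ β → Decidable (X∣ β)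
      X∣? β i = X? i ×-dec (adj G i y Boolₚ.≟ β)
      half : 2 ^ f < # (X∣? true) ⊎ 2 ^ f < # (X∣? false)
      half with 2 ^ f ℕₚ.<? # (X∣? true) | 2 ^ f ℕₚ.<? # (X∣? false)
      ... | yes lt | _      = inj₁ lt
      ... | no _   | yes lt = inj₂ lt
      ... | no ¬t  | no ¬f  = contradiction (ℕₚ.≤-trans (#-∪-≤ (X∣? true) (X∣? false) X? cover)
              (ℕₚ.≤-trans (ℕₚ.+-mono-≤ (ℕₚ.≮⇒≥ ¬t) (ℕₚ.≮⇒≥ ¬f))
                (ℕₚ.≤-reflexive (cong (2 ^ f +_) (sym (ℕₚ.+-identityʳ (2 ^ f))))))) (ℕₚ.<⇒≱ big)
        where
        cover : ∀ i → X i → X∣ true i ⊎ X∣ false i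
        cover i xi with adj G i y
        ... | true  = inj₁ (xi , refl)
        ... | false = inj₂ (xi , refl)
      grow : ∀ β → 2 ^ f < # (X∣? β) → IndepDiffs X Y (suc (suc f))
      grow β lt with g , g∈ , ind ← indepDiffs f (X∣? β) Y? (λ a b xa xb → distinct a b (proj₁ xa) (proj₁ xb)) lt =
        ((a , b) ◂ g) ,
        (λ { zero → xa , xb ; (suc t) → proj₁ (proj₁ (g∈ t)) , proj₁ (proj₂ (g∈ t)) }) ,
        (λ c hyp t → indep-◂ {Y = Y} {φ = row G (ι a ⊖ ι b)} {g = row G ∘ diff ∘ g} (ι y) yy (row-diff-≢0 G ne)
           (λ t → row-diff-0 G (trans (proj₂ (proj₁ (g∈ t))) (sym (proj₂ (proj₂ (g∈ t)))))) ind c hyp t)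

-- Minimality of τ, twins and isotropic vectors

bool-≢-≢ : ∀ {a b c : Bool} → a ≢ b → c ≢ b → a ≡ c
bool-≢-≢ {b = b} a≢b c≢b = trans (Boolₚ.¬-not a≢b) (sym (Boolₚ.¬-not c≢b))

module _ {n} (G : Graph n) where

  Diff : Fin n → Fin n → Fin n → Set
  Diff a b w = adj G a w ≢ adj G b w

  diff? : ∀ a b → Decidable (Diff a b)
  diff? a b w = ¬? (adj G a w Boolₚ.≟ adj G b w)

  module Tau {τ} (isτ : IsTau G τ) where

    τ≤removed : ∀ {X : Fin n → Set} (X? : Decidable X) {u v} → X u → X v → u ≢ v → Same G X u v → τ ≤ # (¬? ∘ X?)
    τ≤removed X? {u} {v} xu xv u≢v same = ℕₚ.≤-trans
      (proj₂ isτ (toSubset X?) (u , ∈-toSubset⁺ X? xu , v , ∈-toSubset⁺ X? xv , u≢v , λ w w∈ → same w (∈-toSubset⁻ X? w∈)))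
      (ℕₚ.≤-reflexive (begin
        n ∸ ∣ toSubset X? ∣                  ≡⟨ cong (n ∸_) (∣toSubset∣ X?) ⟩
        n ∸ # X?                             ≡⟨ cong (_∸ # X?) (sym (#-compl X?)) ⟩
        # X? + # (¬? ∘ X?) ∸ # X?            ≡⟨ ℕₚ.m+n∸m≡n (# X?) _ ⟩
        # (¬? ∘ X?)                          ∎))
      where open ≡-Reasoning

    -- The vertices on which `a` and `b` agree are kept. Nonadjacency puts `a` and `b` themselves
    -- among them.
    τ≤dist : ∀ {a b} → a ≢ b → adj G a b ≡ false → τ ≤ # (diff? a b)
    τ≤dist {a} {b} a≢b ab = τ≤removed (λ w → adj G a w Boolₚ.≟ adj G b w)
      (trans (irrefl G a) (sym (trans (adj-sym G b a) ab))) (trans ab (sym (irrefl G b))) a≢b (λ w eq → eq)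

    removed<τ⇒noTwins : ∀ {X : Fin n → Set} (X? : Decidable X) → # (¬? ∘ X?) < τ → NoTwins G X
    removed<τ⇒noTwins X? lt u v xu xv same =
      decidable-stable (u Finₚ.≟ v) λ u≢v → ℕₚ.<⇒≱ lt (τ≤removed X? xu xv u≢v same)

  reduced-differ : Reduced G → ∀ {a b} → a ≢ b → ∃ λ w → adj G a w ≢ adj G b w
  reduced-differ red {a} {b} a≢b with w , _ , ne ← differ G (λ _ → yes tt) {a} {b} (λ same → a≢b (proj₂ red a b (λ k → same k tt))) = w , ne

  module Kept (red : Reduced G) {r} (rank : HasRank G r) {τ} (isτ : IsTau G τ)
    (K : Subset n) (∣K∣≡ : ∣ K ∣ ≡ n ∸ τ) {rH} (rankK : RankOn G K rH) (r∸3≤rH : r ∸ 3 ≤ rH) where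

    open Tau isτ public

    inK : Fin n → Set
    inK i = i ∈ K

    inK? : Decidable inK
    inK? i = i ∈? K

    T : Fin n → Set
    T i = i ∉ K

    T? : Decidable T
    T? i = ¬? (inK? i)

    τ≤n : τ ≤ n
    τ≤n with K′ , eq , _ ← proj₁ isτ = subst (_≤ n) eq (ℕₚ.m∸n≤m n ∣ K′ ∣)

    #K : # inK? ≡ n ∸ τ
    #K = trans (#∈≡∣∣ K) ∣K∣≡

    #T : # T? ≡ τ
    #T = ℕₚ.+-cancelˡ-≡ (n ∸ τ) (# T?) τ (trans (cong (_+ # T?) (sym #K)) (trans (#-compl inK?) (sym (ℕₚ.m∸n+n≡m τ≤n))))

    Twin : Fin n → Fin n → Set
    Twin u v = inK u × inK v × u ≢ v × Same G inK u v

    twin-sym : ∀ {u v} → Twin u v → Twin v u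
    twin-sym (u∈ , v∈ , u≢v , same) = v∈ , u∈ , u≢v ∘ sym , λ w w∈ → sym (same w w∈)

    -- Otherwise `t` could be returned to K with the twins preserved, at the price of only `τ - 1`
    -- removed vertices.
    twin-T : ∀ {u v} → Twin u v → ∀ {t} → T t → adj G u t ≢ adj G v t
    twin-T {u} {v} (u∈ , v∈ , u≢v , same) {t} t∉ eq = ℕₚ.<-irrefl refl (ℕₚ.≤-trans
      (s≤s (τ≤removed X? (inj₁ u∈) (inj₁ v∈) u≢v same′))
      (ℕₚ.≤-trans (ℕₚ.+-monoˡ-≤ _ (length≤# (t Finₚ.≟_) (t ∷ []) ([] ∷ []) (refl ∷ [])))
        (ℕₚ.≤-trans (#-disjoint-≤ (t Finₚ.≟_) (¬? ∘ X?) T? (λ { i refl → t∉ }) (λ i ¬x i∈ → ¬x (inj₁ i∈)) (λ i eq ¬x → ¬x (inj₂ eq)))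
          (ℕₚ.≤-reflexive #T))))
      where
      X? : Decidable (λ i → inK i ⊎ t ≡ i)
      X? i = inK? i ⊎-dec (t Finₚ.≟ i)
      same′ : Same G (λ i → inK i ⊎ t ≡ i) u v
      same′ w (inj₁ w∈)   = same w w∈
      same′ w (inj₂ refl) = eq

    twin-vanishes : ∀ {u v} → Twin u v → VanishesOn G inK (ι u ⊖ ι v)
    twin-vanishes (_ , _ , _ , same) j j∈ = row-diff-0 G (same j j∈)

    twin-row-T : ∀ {u v} → Twin u v → ∀ {t} → T t → row G (ι u ⊖ ι v) t ≢ 0ℚ
    twin-row-T tw t∉ = row-diff-≢0 G (twin-T tw t∉)

    -- Two independent isotropic vectors orthogonal to K would make the rank of K at most r − 4.
    not-two-isotropic : ∀ a b → Supp inK a → Supp inK b → VanishesOn G inK a → VanishesOn G inK b → ∀ t t′ →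
      row G a t ≡ 0ℚ → row G a t′ ≢ 0ℚ → row G b t ≢ 0ℚ → ⊥
    not-two-isotropic a b sa sb a0 b0 t t′ at≡0 at′≢0 bt≢0 =
      ℕₚ.<-irrefl refl (ℕₚ.≤-trans four≤ (ℕₚ.≤-trans (ℕₚ.m≤n+m∸n r 3) (ℕₚ.+-monoʳ-≤ 3 r∸3≤rH)))
      where
      x = proj₁ (proj₁ rankK)
      x∈ = proj₁ (proj₂ (proj₁ rankK))
      ix = proj₂ (proj₂ (proj₁ rankK))
      h : Fin 2 → Term n
      h = b ◂ a ◂ ∅
      g : Fin (rH + 2) → Term n
      g = (ι ∘ x) ⧺ h
      ih : IndepOn Everywhere (row G ∘ h)
      ih c hyp = indep-◂ {φ = row G b} {g = row G a ◂ ∅} (ι t) tt bt≢0 (λ { zero → at≡0 })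
        (indep-single {φ = row G a} t′ tt at′≢0) c hyp
      ig : IndepOn Everywhere (row G ∘ g)
      ig = indep-⧺ (row G) {g = ι ∘ x} (λ _ _ → tt) ix (λ { zero → b0 ; (suc zero) → a0 }) ih
      kill : ∀ c → VanishesOn G inK c → ∀ s → ev c (row G (g s)) ≡ 0ℚ
      kill c c0 = ⧺-all (λ s → ev c (row G s) ≡ 0ℚ) (ι ∘ x) h (λ s → vanishes-ev G c (ι (x s)) c0 (x∈ s))
        λ { zero → vanishes-ev G c b c0 sb ; (suc zero) → vanishes-ev G c a c0 sa }
      -- Besides the `rH` rows from K and the vectors `a`, `b` themselves, the rows of `t` and `t′`
      -- count: pairing with `a` detects `t′` but not `t`, and pairing with `b` detects `t`.
      four≤ : 4 + rH ≤ r
      four≤ = subst (_≤ r) (cong (2 +_) (ℕₚ.+-comm rH 2)) (indep⇒≤rank G rank (ι t′ ◂ ι t ◂ g)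
        (λ c hyp → indep-◂ {φ = A G t′} {g = A G t ◂ (row G ∘ g)} a (supp-everywhere a)
          (λ eq → at′≢0 (trans (ev-sym G (ι t′) a) eq))
          (λ { zero → trans (ev-sym G a (ι t)) at≡0 ; (suc s) → kill a a0 s })
          (indep-◂ {φ = A G t} {g = row G ∘ g} b (supp-everywhere b) (λ eq → bt≢0 (trans (ev-sym G (ι t) b) eq)) (kill b b0) ig)
          c hyp))

    module Pair (u₀ v₀ : Fin n) (tw₀ : Twin u₀ v₀) where

      z : Term n
      z = ι u₀ ⊖ ι v₀

      z-supp : Supp inK z
      z-supp = proj₁ tw₀ , proj₁ (proj₂ tw₀)

      z-vanishes : VanishesOn G inK z
      z-vanishes = twin-vanishes tw₀

      t₀ : Fin n
      t₀ = proj₁ (reduced-differ red (proj₁ (proj₂ (proj₂ tw₀))))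

      t₀∈T : T t₀
      t₀∈T t₀∈ = proj₂ (reduced-differ red (proj₁ (proj₂ (proj₂ tw₀)))) (proj₂ (proj₂ (proj₂ tw₀)) t₀ t₀∈)

      z-T : ∀ {t} → T t → row G z t ≢ 0ℚ
      z-T = twin-row-T tw₀

      T<n : # T? < n
      T<n = #-∁-< T? u₀ (λ u₀∉ → u₀∉ (proj₁ tw₀))

      -- An isotropic vector costs two dimensions: `z` is invisible on K, and the row of `t₀` is
      -- detected by pairing with `z`, which kills everything else.
      rank-K : RankAtMost G inK (r ∸ 2)
      rank-K k x x∈ ix = rank-drop₁ G rank x x∈ ix (z ◂ ∅) (λ { zero → z-vanishes })
        (λ c hyp → indep-single {φ = row G z} t₀ tt (z-T t₀∈T) c hyp) z (ι t₀) z-vanishes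
        (λ { zero → vanishes-ev G z z z-vanishes z-supp }) (λ eq → z-T t₀∈T (trans (ev-sym G (ι t₀) z) eq))

      -- If u agreed with u₀ at t and not at t′, then u − v and u₀ − v₀ would be independent.
      twin-side : ∀ {u v} → Twin u v → Same G T u u₀ ⊎ Same G T u v₀
      twin-side {u} {v} tw with same? G T? u u₀
      ... | yes same = inj₁ same
      ... | no ¬same with t′ , t′∉ , ne ← differ G T? {u} {u₀} ¬same = inj₂ λ t t∉ →
        bool-≢-≢ {b = adj G u₀ t} (λ eq → clash t t∉ eq) (twin-T tw₀ t∉ ∘ sym)
        where
        clash : ∀ t → T t → adj G u t ≢ adj G u₀ t
        clash t t∉ eq = not-two-isotropic ((ι u ⊖ ι v) ⊖ z) z ((proj₁ tw , proj₁ (proj₂ tw)) , z-supp) z-supp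
          (λ j j∈ → cong₂ _-ℚ_ (twin-vanishes tw j j∈) (z-vanishes j j∈)) z-vanishes t t′
          (at-t eq (bool-≢-≢ {b = adj G u t} (twin-T tw t∉ ∘ sym) (λ e → twin-T tw₀ t∉ (trans (sym eq) (sym e)))))
          (at-t′ ne (twin-T tw t′∉) (twin-T tw₀ t′∉)) (z-T t∉)
          where
          at-t : ∀ {t} → adj G u t ≡ adj G u₀ t → adj G v t ≡ adj G v₀ t → row G ((ι u ⊖ ι v) ⊖ z) t ≡ 0ℚ
          at-t {t} e e′ rewrite e | e′ with adj G u₀ t | adj G v₀ t
          ... | true  | true  = refl
          ... | true  | false = refl
          ... | false | true  = refl
          ... | false | false = refl
          at-t′ : ∀ {t} → adj G u t ≢ adj G u₀ t → adj G u t ≢ adj G v t → adj G u₀ t ≢ adj G v₀ t →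
            row G ((ι u ⊖ ι v) ⊖ z) t ≢ 0ℚ
          at-t′ {t} a b c with adj G u t | adj G v t | adj G u₀ t | adj G v₀ t
          ... | true  | true  | _     | _     = λ _ → b refl
          ... | false | false | _     | _     = λ _ → b refl
          ... | true  | false | true  | _     = λ _ → a refl
          ... | false | true  | false | _     = λ _ → a refl
          ... | true  | false | false | false = λ _ → c refl
          ... | false | true  | true  | true  = λ _ → c refl
          ... | true  | false | false | true  = λ ()
          ... | false | true  | true  | false = λ ()

      -- As a vector, a vertex isolated in K is isotropic and zero on K. By `not-two-isotropic`, a
      -- zero at one vertex of T would make it zero everywhere, against reducedness.
      isolated-T : ∀ {w} → inK w → Isolated G inK w → ∀ t → T t → adj G w t ≡ true
      isolated-T {w} w∈ iso t t∉ with adj G w t in wt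
      ... | true  = refl
      ... | false with j , wj ← proj₁ red w = ⊥-elim (not-two-isotropic (ι w) z w∈ z-supp
              (λ j j∈ → A-false G (iso j j∈)) z-vanishes t j (A-false G wt) (A-≢0 G wj) (z-T t∉))

      -- The isolated vertex is constantly 1 on T, so `z`, being proportional to it, cannot change
      -- sign there.
      isolated-constant : ∀ {w} → inK w → Isolated G inK w → ∀ t t′ → T t → T t′ → adj G u₀ t ≡ true → adj G u₀ t′ ≡ true
      isolated-constant {w} w∈ iso t t′ t∉ t′∉ ut with adj G u₀ t′ in ut′
      ... | true  = refl
      ... | false = ⊥-elim (not-two-isotropic (z ⊖ ι w) z (z-supp , w∈) z-supp
              (λ j j∈ → cong₂ _-ℚ_ (z-vanishes j j∈) (A-false G (iso j j∈))) z-vanishes t t′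
              (at-t ut (Boolₚ.¬-not (λ e → twin-T tw₀ t∉ (trans ut (sym e)))) (isolated-T w∈ iso t t∉))
              (at-t′ ut′ (isolated-T w∈ iso t′ t′∉)) (z-T t∉))
        where
        at-t : ∀ {t} → adj G u₀ t ≡ true → adj G v₀ t ≡ false → adj G w t ≡ true → row G (z ⊖ ι w) t ≡ 0ℚ
        at-t a b c rewrite a | b | c = refl
        at-t′ : ∀ {t} → adj G u₀ t ≡ false → adj G w t ≡ true → row G (z ⊖ ι w) t ≢ 0ℚ
        at-t′ {t} a c rewrite a | c with adj G v₀ t
        ... | true  = λ ()
        ... | false = λ ()

-- Decomposition of the vertex set, and bounds on T and S

module Structure {n} (G : Graph n) (red : Reduced G) {r} (rank : HasRank G r) (minimal : MinimalCounterexampleOrder n)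
  (large : 3 + 2 * m (r ∸ 2) ≤ n) {τ} (isτ : IsTau G τ) (K : Subset n) (∣K∣≡ : ∣ K ∣ ≡ n ∸ τ)
  {rH} (rankK : RankOn G K rH) (r∸3≤rH : r ∸ 3 ≤ rH) where

  open Kept G red rank isτ K ∣K∣≡ rankK r∸3≤rH public

  IsoK : Fin n → Set
  IsoK k = inK k × Isolated G inK k

  isoK? : Decidable IsoK
  isoK? k = inK? k ×-dec isolated? G inK? k

  Dup : Fin n → Set
  Dup k = ∃ (Twin k)

  dup? : Decidable Dup
  dup? k = Finₚ.any? (λ v → inK? k ×-dec (inK? v ×-dec (¬? (k Finₚ.≟ v) ×-dec same? G inK? k v)))

  agree⇒≡ : ∀ {a b} → Same G inK a b → Same G T a b → a ≡ b
  agree⇒≡ {a} {b} sK sT = proj₂ red a b λ w → pick-side w (inK? w)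
    where
    pick-side : ∀ w → Dec (inK w) → adj G a w ≡ adj G b w
    pick-side w (yes w∈) = sK w w∈
    pick-side w (no w∉)  = sT w w∉

  module Oriented (u₀ v₀ : Fin n) (tw₀ : Twin u₀ v₀) (oriented : ∀ w → IsoK w → Same G T w u₀) where

    open Pair u₀ v₀ tw₀ public

    -- S is the paper's S with representatives on the side of u₀, together with the isolated vertex of G[K];
    -- K₀ is the reduction of G[K].
    S C K₁ K₀ : Fin n → Set
    S k  = (Dup k ⊎ IsoK k) × Same G T k u₀
    C k  = Dup k × Same G T k v₀
    K₁ k = inK k × ¬ Dup k × ¬ IsoK k
    K₀ k  = C k ⊎ K₁ k

    S? : Decidable S
    S? k = (dup? k ⊎-dec isoK? k) ×-dec same? G T? k u₀

    C? : Decidable C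
    C? k = dup? k ×-dec same? G T? k v₀

    K₁? : Decidable K₁
    K₁? k = inK? k ×-dec (¬? (dup? k) ×-dec ¬? (isoK? k))

    K₀? : Decidable K₀
    K₀? k = C? k ⊎-dec K₁? k

    dup⇒inK : ∀ {k} → Dup k → inK k
    dup⇒inK (_ , k∈ , _) = k∈

    S⇒inK : ∀ {k} → S k → inK k
    S⇒inK (inj₁ d , _) = dup⇒inK d
    S⇒inK (inj₂ i , _) = proj₁ i

    C⇒inK : ∀ {k} → C k → inK k
    C⇒inK (d , _) = dup⇒inK d

    K₀⇒inK : ∀ {k} → K₀ k → inK k
    K₀⇒inK (inj₁ c) = C⇒inK c
    K₀⇒inK (inj₂ k) = proj₁ k

    cover : ∀ k → inK k → S k ⊎ K₀ k
    cover k k∈ with dup? k | isoK? k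
    ... | no ¬d       | yes i = inj₁ (inj₂ i , oriented k i)
    ... | no ¬d       | no ¬i = inj₂ (inj₂ (k∈ , ¬d , ¬i))
    ... | yes (v , t) | _ with twin-side t
    ...   | inj₁ s = inj₁ (inj₁ (v , t) , s)
    ...   | inj₂ s = inj₂ (inj₁ ((v , t) , s))

    opposite : ∀ {k} → Same G T k u₀ → ¬ Same G T k v₀
    opposite su sv = twin-T tw₀ t₀∈T (trans (sym (su t₀ t₀∈T)) (sv t₀ t₀∈T))

    dup⇒¬iso : ∀ {k} → Dup k → ¬ IsoK k
    dup⇒¬iso (v , k∈ , v∈ , k≢v , same) (_ , iso) = k≢v (agree⇒≡ same λ t t∉ →
      trans (isolated-T k∈ iso t t∉) (sym (isolated-T v∈ (λ w w∈ → trans (sym (same w w∈)) (iso w w∈)) t t∉)))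

    S∩K₀ : ∀ k → S k → ¬ K₀ k
    S∩K₀ k (_ , su)      (inj₁ (_ , sv))     = opposite su sv
    S∩K₀ k (inj₁ d , su) (inj₂ (_ , ¬d , _)) = ¬d d
    S∩K₀ k (inj₂ i , su) (inj₂ (_ , _ , ¬i)) = ¬i i

    twin-of-S : ∀ {k v} → Twin k v → Same G T k u₀ → C v
    twin-of-S tw su with twin-side (twin-sym tw)
    ... | inj₁ s = ⊥-elim (twin-T tw t₀∈T (trans (su t₀ t₀∈T) (sym (s t₀ t₀∈T))))
    ... | inj₂ s = (_ , twin-sym tw) , s

    twin-of-C : ∀ {k v} → Twin k v → Same G T k v₀ → S v
    twin-of-C tw sv with twin-side (twin-sym tw)
    ... | inj₁ s = inj₁ (_ , twin-sym tw) , s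
    ... | inj₂ s = ⊥-elim (twin-T tw t₀∈T (trans (sv t₀ t₀∈T) (sym (s t₀ t₀∈T))))

    twin-adj : ∀ {k v w} → Twin k v → inK w → adj G w k ≡ adj G w v
    twin-adj {k} {v} {w} (_ , _ , _ , same) w∈ = trans (adj-sym G w k) (trans (same w w∈) (adj-sym G v w))

    iso-unique : ∀ i j → IsoK i → IsoK j → i ≡ j
    iso-unique i j (i∈ , iso-i) (j∈ , iso-j) = agree⇒≡ (λ w w∈ → trans (iso-i w w∈) (sym (iso-j w w∈)))
      (λ t t∉ → trans (isolated-T i∈ iso-i t t∉) (sym (isolated-T j∈ iso-j t t∉)))

    #S≤#C+#Iso : # S? ≤ # C? + # isoK?
    #S≤#C+#Iso = ℕₚ.≤-trans (#-∪-≤ S₂? isoK? S? split)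
      (ℕₚ.+-monoˡ-≤ (# isoK?) (#-inject S₂? C? (λ k s → proj₁ (proj₁ s)) (λ k s → twin-of-S (proj₂ (proj₁ s)) (proj₂ s))
        λ { i ((v , ti) , si) j ((.v , tj) , sj) refl → agree⇒≡
              (λ w w∈ → trans (proj₂ (proj₂ (proj₂ ti)) w w∈) (sym (proj₂ (proj₂ (proj₂ tj)) w w∈)))
              (λ t t∉ → trans (si t t∉) (sym (sj t t∉))) }))
      where
      S₂? : Decidable (λ k → Dup k × Same G T k u₀)
      S₂? k = dup? k ×-dec same? G T? k u₀
      split : ∀ k → S k → (Dup k × Same G T k u₀) ⊎ IsoK k
      split k (inj₁ d , s) = inj₁ (d , s)
      split k (inj₂ i , s) = inj₂ i

    #S≤1+#C : # S? ≤ suc (# C?)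
    #S≤1+#C = ℕₚ.≤-trans #S≤#C+#Iso (ℕₚ.≤-trans (ℕₚ.+-monoʳ-≤ (# C?) (#-≤1 isoK? iso-unique)) (ℕₚ.≤-reflexive (ℕₚ.+-comm (# C?) 1)))

    #C≤#K₀ : # C? ≤ # K₀?
    #C≤#K₀ = #-mono C? K₀? (λ _ → inj₁)

    n≤τ+S+K₀ : n ≤ τ + (# S? + # K₀?)
    n≤τ+S+K₀ = ℕₚ.≤-trans (ℕₚ.≤-reflexive (sym (#-compl inK?))) (ℕₚ.≤-trans (ℕₚ.≤-reflexive (trans (cong (# inK? +_) #T) (ℕₚ.+-comm _ τ)))
      (ℕₚ.+-monoʳ-≤ τ (#-∪-≤ S? K₀? inK? cover)))

    S+C+K₁≤n : τ + (# S? + (# C? + # K₁?)) ≤ n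
    S+C+K₁≤n = ℕₚ.≤-trans (ℕₚ.+-monoʳ-≤ τ (ℕₚ.≤-trans
        (ℕₚ.+-monoʳ-≤ (# S?) (#-disjoint-≤ C? K₁? K₀? (λ _ → inj₁) (λ _ → inj₂) (λ { k (d , _) (_ , ¬d , _) → ¬d d })))
        (#-disjoint-≤ S? K₀? inK? (λ _ → S⇒inK) (λ _ → K₀⇒inK) S∩K₀)))
      (ℕₚ.≤-reflexive (trans (ℕₚ.+-comm τ (# inK?)) (trans (cong (# inK? +_) (sym #T)) (#-compl inK?))))

    -- The vertices of K left out of `K₀` separate nothing new: a duplicated one has a twin in `C`
    -- with the same column on K, and the column of an isolated one is zero.
    same-K₀⇒K : ∀ {u v} → inK u → inK v → Same G K₀ u v → Same G inK u v
    same-K₀⇒K {u} {v} u∈ v∈ same k k∈ with cover k k∈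
    ... | inj₂ h                       = same k h
    ... | inj₁ (inj₁ (k′ , tw) , s)    = trans (twin-adj tw u∈) (trans (same k′ (inj₁ (twin-of-S tw s))) (sym (twin-adj tw v∈)))
    ... | inj₁ (inj₂ (_ , iso) , s)    = trans (trans (adj-sym G u k) (iso u u∈)) (sym (trans (adj-sym G v k) (iso v v∈)))

    K₀-noTwins : NoTwins G K₀
    K₀-noTwins u v hu hv same = decidable-stable (u Finₚ.≟ v) λ u≢v → clash u≢v hu hv
      where
      sK = same-K₀⇒K (K₀⇒inK hu) (K₀⇒inK hv) same
      clash : u ≢ v → K₀ u → K₀ v → ⊥
      clash u≢v (inj₁ (_ , su)) (inj₁ (_ , sv))       = u≢v (agree⇒≡ sK λ t t∉ → trans (su t t∉) (sym (sv t t∉)))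
      clash u≢v (inj₂ (_ , ¬d , _)) hv               = ¬d (v , K₀⇒inK hu , K₀⇒inK hv , u≢v , sK)
      clash u≢v (inj₁ _) (inj₂ (_ , ¬d , _))         = ¬d (u , twin-sym (K₀⇒inK hu , K₀⇒inK hv , u≢v , sK))

    K₀-noIsolated : NoIsolated G K₀
    K₀-noIsolated u hu iso = clash hu
      where
      isoK : IsoK u
      isoK = K₀⇒inK hu , λ k k∈ → at k (cover k k∈)
        where
        at : ∀ k → S k ⊎ K₀ k → adj G u k ≡ false
        at k (inj₂ h)                    = iso k h
        at k (inj₁ (inj₁ (k′ , tw) , s)) = trans (twin-adj tw (K₀⇒inK hu)) (iso k′ (inj₁ (twin-of-S tw s)))
        at k (inj₁ (inj₂ (_ , i) , s))   = trans (adj-sym G u k) (i u (K₀⇒inK hu))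
      clash : ¬ K₀ u
      clash (inj₁ (d , _))       = dup⇒¬iso d isoK
      clash (inj₂ (_ , _ , ¬i)) = ¬i isoK

    #K₀≤ : ∀ {ρ} → RankAtMost G inK ρ → # K₀? ≤ m ρ
    #K₀≤ rk = order≤m G minimal K₀? (#-∁-< K₀? t₀ (λ h → t₀∈T (K₀⇒inK h))) K₀-noTwins K₀-noIsolated (rankAtMost-⊆ G (λ _ → K₀⇒inK) rk)

    M = m (r ∸ 2)

    n≤τ+S+M : n ≤ τ + (# S? + M)
    n≤τ+S+M = ℕₚ.≤-trans n≤τ+S+K₀ (ℕₚ.+-monoʳ-≤ τ (ℕₚ.+-monoʳ-≤ (# S?) (#K₀≤ rank-K)))

    -- The bound `n ≤ τ + |S| + M` gives `|C| + |K₁| ≤ M`, and with `3 + 2M ≤ n` it gives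
    -- `τ ≥ M + 3 - |S| ≥ M + 2 - |C|`. Nonadjacent vertices therefore cannot differ inside `K₁`
    -- only, and on this rests the absence of twins in S and in each side of T.
    #K₁<τ : # K₁? < τ
    #K₁<τ = few (# S?) (# C?) (# K₁?) M S+C+K₁≤n #S≤1+#C n≤τ+S+M large
      where
      few : ∀ s c k M → τ + (s + (c + k)) ≤ n → s ≤ suc c → n ≤ τ + (s + M) → 3 + 2 * M ≤ n → suc k ≤ τ
      few s c k M a b d e = ℕₚ.≤-trans (ℕₚ.n≤1+n (suc k)) (ℕₚ.+-cancelʳ-≤ (τ + s + c + 2 * M + 1 + n + n) (2 + k) τ (begin
        2 + k + (τ + s + c + 2 * M + 1 + n + n)
          ≡⟨ solveℕ 6 (λ k τ s c M n → #c 2 ⊕ k ⊕ (τ ⊕ s ⊕ c ⊕ #c 2 ⊗ M ⊕ #c 1 ⊕ n ⊕ n)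
               ≔ (τ ⊕ (s ⊕ (c ⊕ k))) ⊕ (#c 3 ⊕ #c 2 ⊗ M) ⊕ (n ⊕ n)) refl k τ s c M n ⟩
        (τ + (s + (c + k))) + (3 + 2 * M) + (n + n)
          ≤⟨ ℕₚ.+-mono-≤ (ℕₚ.+-mono-≤ a e) (ℕₚ.+-mono-≤ d d) ⟩
        n + n + (τ + (s + M) + (τ + (s + M)))
          ≡⟨ solveℕ 4 (λ n τ s M → n ⊕ n ⊕ (τ ⊕ (s ⊕ M) ⊕ (τ ⊕ (s ⊕ M))) ≔ s ⊕ (n ⊕ n ⊕ (τ ⊕ τ ⊕ s ⊕ #c 2 ⊗ M))) refl n τ s M ⟩
        s + (n + n + (τ + τ + s + 2 * M))
          ≤⟨ ℕₚ.+-monoˡ-≤ _ b ⟩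
        suc c + (n + n + (τ + τ + s + 2 * M))
          ≡⟨ solveℕ 5 (λ c n τ s M → #c 1 ⊕ c ⊕ (n ⊕ n ⊕ (τ ⊕ τ ⊕ s ⊕ #c 2 ⊗ M)) ≔ τ ⊕ (τ ⊕ s ⊕ c ⊕ #c 2 ⊗ M ⊕ #c 1 ⊕ n ⊕ n)) refl c n τ s M ⟩
        τ + (τ + s + c + 2 * M + 1 + n + n) ∎))
        where open ℕₚ.≤-Reasoning

    Side : Bool → Fin n → Set
    Side β t = T t × adj G u₀ t ≡ β

    side? : ∀ β → Decidable (Side β)
    side? β t = T? t ×-dec (adj G u₀ t Boolₚ.≟ β)

    side-S : ∀ {β p k} → Side β p → S k → adj G p k ≡ β
    side-S {β} {p} {k} (p∉ , e) (_ , s) = trans (adj-sym G p k) (trans (s p p∉) e)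

    side-C : ∀ {β p k} → Side β p → C k → adj G p k ≡ not β
    side-C {β} {p} {k} (p∉ , e) (_ , s) = trans (adj-sym G p k) (trans (s p p∉)
      (Boolₚ.¬-not (λ e′ → twin-T tw₀ p∉ (trans e (sym e′)))))

    u₀∈S : S u₀
    u₀∈S = inj₁ (v₀ , tw₀) , λ _ _ → refl

    v₀∈C : C v₀
    v₀∈C = (u₀ , twin-sym tw₀) , λ _ _ → refl

    differ-in-K₁ : ∀ {β p p′} → Side β p → Side β p′ → ∀ k → Diff G p p′ k → inK k → K₁ k
    differ-in-K₁ sp sp′ k ne k∈ with cover k k∈
    ... | inj₁ s        = ⊥-elim (ne (trans (side-S sp s) (sym (side-S sp′ s))))
    ... | inj₂ (inj₁ c) = ⊥-elim (ne (trans (side-C sp c) (sym (side-C sp′ c))))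
    ... | inj₂ (inj₂ k) = k

    ¬[Diff⊆K₁] : ∀ {a b} → a ≢ b → adj G a b ≡ false → ¬ (∀ k → Diff G a b k → K₁ k)
    ¬[Diff⊆K₁] {a} {b} a≢b ab sub = ℕₚ.<⇒≱ #K₁<τ (ℕₚ.≤-trans (τ≤dist a≢b ab) (#-mono (diff? G a b) K₁? sub))

    -- Vertices of T with the same neighbours in T are nonadjacent; on one side they also agree on
    -- `S` and `C`, so only `K₁` is left to separate them.
    side-noTwins : ∀ {β p p′} → Side β p → Side β p′ → Same G T p p′ → p ≡ p′
    side-noTwins {β} {p} {p′} sp sp′ same = decidable-stable (p Finₚ.≟ p′) λ p≢p′ →
      ¬[Diff⊆K₁] p≢p′ (trans (same p′ (proj₁ sp′)) (irrefl G p′)) λ k ne →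
        differ-in-K₁ sp sp′ k ne (decidable-stable (inK? k) λ k∉ → ne (same k k∉))

    -- Two such vertices are nonadjacent and agree on T by the choice of side, and on `C` because
    -- each vertex of `C` has a twin in `S`.
    S-noTwins : NoTwins G S
    S-noTwins a b sa sb same = decidable-stable (a Finₚ.≟ b) λ a≢b →
      ¬[Diff⊆K₁] a≢b (trans (same b sb) (irrefl G b)) λ k ne → at k ne (inK? k)
      where
      at : ∀ k → Diff G a b k → Dec (inK k) → K₁ k
      at k ne (no k∉)  = ⊥-elim (ne (trans (proj₂ sa k k∉) (sym (proj₂ sb k k∉))))
      at k ne (yes k∈) with cover k k∈
      ... | inj₁ s                        = ⊥-elim (ne (same k s))
      ... | inj₂ (inj₁ ((k′ , tw) , s))   = ⊥-elim (ne (trans (twin-adj tw (S⇒inK sa))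
                                              (trans (same k′ (twin-of-C tw s)) (sym (twin-adj tw (S⇒inK sb))))))
      ... | inj₂ (inj₂ k₁)                = k₁

    S<n : # S? < n
    S<n = #-∁-< S? t₀ (λ s → t₀∈T (S⇒inK s))

    module _ {φ} (D : IndepDiffs G S Everywhere φ) where

      private
        f : Fin φ → Term n
        f = diff G ∘ proj₁ D

        f-supp : ∀ t → Supp inK (f t)
        f-supp t = S⇒inK (proj₁ (proj₁ (proj₂ D) t)) , S⇒inK (proj₂ (proj₁ (proj₂ D) t))

        f-vanishes : ∀ t → VanishesOn G T (f t)
        f-vanishes t j j∉ = row-diff-0 G (trans (proj₂ (proj₁ (proj₁ (proj₂ D) t)) j j∉) (sym (proj₂ (proj₂ (proj₁ (proj₂ D) t)) j j∉)))

      rank-T : RankAtMost G T (r ∸ φ)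
      rank-T k x x∈ ix = rank-drop₀ G rank x ix f f-vanishes (proj₂ (proj₂ D))

      -- Beyond the `φ` differences two more vectors count: `w`, which is invisible on T, and `z`,
      -- which is detected by `w` because `w` is isotropic and orthogonal to the rest of the family.
      rank-T′ : ∀ w → Supp T w → VanishesOn G T w → ev w (row G z) ≢ 0ℚ → RankAtMost G T (r ∸ (2 + φ))
      rank-T′ w sw w0 wz≢0 k x x∈ ix = rank-drop₁ G rank x x∈ ix (w ◂ f) (λ { zero → w0 ; (suc t) → f-vanishes t })
        (λ c hyp → indep-◂ {φ = row G w} {g = row G ∘ f} z (supp-everywhere z) (λ eq → wz≢0 (trans (ev-sym G w z) eq))
          (λ t → vanishes-ev G z (f t) z-vanishes (f-supp t)) (proj₂ (proj₂ D)) c hyp)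
        w z w0 (λ { zero → vanishes-ev G w w w0 sw ; (suc t) → ev-vanishes G w (f t) sw (f-vanishes t) }) wz≢0

      DupT : Fin n → Set
      DupT t = ∃ λ q → T q × t ≢ q × Same G T t q

      dupT? : Decidable DupT
      dupT? t = Finₚ.any? (λ q → T? q ×-dec (¬? (t Finₚ.≟ q) ×-dec same? G T? t q))

      -- Twins of G[T] lie on different sides, so dropping those on one side leaves no twins.
      τ≤double : ∀ {ρ} → RankAtMost G T ρ → τ ≤ 2 + 2 * m ρ
      -- The two sides are treated in turn and the bounds added: the sets of dropped twins are
      -- disjoint, so together they cost at most `τ`. Each side contributes 1 for a possible
      -- isolated vertex.
      τ≤double {ρ} rk = ℕₚ.+-cancelʳ-≤ τ τ (2 + 2 * m ρ) (begin
        τ + τ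
          ≡⟨ cong₂ _+_ (sym #T) (sym #T) ⟩
        # T? + # T?
          ≤⟨ ℕₚ.+-mono-≤ (#-∪-≤ (Y? true) (Z? true) T? (split true)) (#-∪-≤ (Y? false) (Z? false) T? (split false)) ⟩
        # (Y? true) + # (Z? true) + (# (Y? false) + # (Z? false))
          ≤⟨ ℕₚ.+-mono-≤ (ℕₚ.+-monoˡ-≤ _ (Y≤ true)) (ℕₚ.+-monoˡ-≤ _ (Y≤ false)) ⟩
        suc (m ρ) + # (Z? true) + (suc (m ρ) + # (Z? false))
          ≡⟨ solveℕ 3 (λ a b c → #c 1 ⊕ a ⊕ b ⊕ (#c 1 ⊕ a ⊕ c) ≔ #c 2 ⊕ #c 2 ⊗ a ⊕ (b ⊕ c)) refl (m ρ) (# (Z? true)) (# (Z? false)) ⟩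
        2 + 2 * m ρ + (# (Z? true) + # (Z? false))
          ≤⟨ ℕₚ.+-monoʳ-≤ (2 + 2 * m ρ) (ℕₚ.≤-trans (#-disjoint-≤ (Z? true) (Z? false) T? (λ _ z → proj₁ (proj₂ z)) (λ _ z → proj₁ (proj₂ z))
               (λ { k (_ , _ , e) (_ , _ , e′) → Boolₚ.not-¬ e e′ })) (ℕₚ.≤-reflexive #T)) ⟩
        2 + 2 * m ρ + τ ∎)
        where
        open ℕₚ.≤-Reasoning
        Z Y : Bool → Fin n → Set
        Z β t = DupT t × Side β t
        Y β t = T t × ¬ Z β t
        Z? : ∀ β → Decidable (Z β)
        Z? β t = dupT? t ×-dec side? β t
        Y? : ∀ β → Decidable (Y β)
        Y? β t = T? t ×-dec ¬? (Z? β t)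
        split : ∀ β t → T t → Y β t ⊎ Z β t
        split β t t∉ with Z? β t
        ... | yes z = inj₂ z
        ... | no ¬z = inj₁ (t∉ , ¬z)
        Y-noTwins : ∀ β → NoTwins G (Y β)
        Y-noTwins β u v (u∉ , ¬zu) (v∉ , ¬zv) same = decidable-stable (u Finₚ.≟ v) λ u≢v → u≢v (side-noTwins {β = not β}
            (u∉ , Boolₚ.¬-not (λ e → ¬zu ((v , v∉ , u≢v , sT) , u∉ , e)))
            (v∉ , Boolₚ.¬-not (λ e → ¬zv ((u , u∉ , u≢v ∘ sym , λ w w∉ → sym (sT w w∉)) , v∉ , e))) sT)
          where
          sT : Same G T u v
          sT k k∉ with split β k k∉
          ... | inj₁ y = same k y
          ... | inj₂ ((q , q∉ , k≢q , sq) , sk) = trans (through u u∉) (trans (same q yq) (sym (through v v∉)))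
            where
            through : ∀ w → T w → adj G w k ≡ adj G w q
            through w w∉ = trans (adj-sym G w k) (trans (sq w w∉) (adj-sym G q w))
            yq : Y β q
            yq = q∉ , λ { (_ , sq′) → k≢q (side-noTwins sk sq′ sq) }
        Y≤ : ∀ β → # (Y? β) ≤ suc (m ρ)
        Y≤ β = order≤1+m G minimal (Y? β) (ℕₚ.≤-<-trans (#-mono (Y? β) T? (λ _ → proj₁)) T<n) (Y-noTwins β)
          (rankAtMost-⊆ G (λ _ → proj₁) rk)

      -- If T is not reduced, a twin pair or an isolated vertex is the isotropic `w` of `rank-T′`;
      -- the two extra dimensions make up for the doubling in `τ≤double`.
      τ≤m : 4 + φ ≤ r → τ ≤ m (r ∸ φ)
      τ≤m 4+φ≤r with Finₚ.any? (λ p → T? p ×-dec dupT? p) | Finₚ.any? (λ p → T? p ×-dec isolated? G T? p)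
      ... | no noDup | no noIso = subst (_≤ m (r ∸ φ)) #T (order≤m G minimal T? T<n
              (λ u v u∉ v∉ same → decidable-stable (u Finₚ.≟ v) λ u≢v → noDup (u , u∉ , v , v∉ , u≢v , same))
              (λ u u∉ iso → noIso (u , u∉ , iso)) rank-T)
      ... | yes (p , p∉ , q , q∉ , p≢q , same) | _ = ℕₚ.≤-trans (τ≤double (rank-T′ (ι p ⊖ ι q) (p∉ , q∉)
              (λ j j∉ → row-diff-0 G (same j j∉)) opp)) (ℕₚ.≤-reflexive (m-step-∸ 4+φ≤r))
        where
        -- `p` and `q` lie on different sides, where `z` takes the values 1 and -1, so the
        -- difference is 2 or -2.
        opp : row G z p -ℚ row G z q ≢ 0ℚ
        opp = values (λ e → p≢q (side-noTwins (p∉ , refl) (q∉ , sym e) same)) (twin-T tw₀ p∉) (twin-T tw₀ q∉)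
          where
          values : adj G u₀ p ≢ adj G u₀ q → adj G u₀ p ≢ adj G v₀ p → adj G u₀ q ≢ adj G v₀ q → row G z p -ℚ row G z q ≢ 0ℚ
          values a b c with adj G u₀ p | adj G v₀ p | adj G u₀ q | adj G v₀ q
          ... | true  | true  | _     | _     = λ _ → b refl
          ... | false | false | _     | _     = λ _ → b refl
          ... | true  | false | true  | _     = λ _ → a refl
          ... | false | true  | false | _     = λ _ → a refl
          ... | true  | false | false | false = λ _ → c refl
          ... | false | true  | true  | true  = λ _ → c refl
          ... | true  | false | false | true  = λ ()
          ... | false | true  | true  | false = λ ()
      ... | no _ | yes (p , p∉ , iso) = ℕₚ.≤-trans (τ≤double (rank-T′ (ι p) p∉ (λ j j∉ → A-false G (iso j j∉)) (z-T p∉)))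
              (ℕₚ.≤-reflexive (m-step-∸ 4+φ≤r))

    -- Differences within one side vanish on `S` and are orthogonal to `z`, since each of `u₀`, `v₀`
    -- is constant on a side. With `z` and the row of `t₀`, which `z` detects, the drop is `d + 2`.
    -- Independence is asked on K because `z` vanishes there and can be appended. The extra 1 allows
    -- for an isolated vertex of `S`.
    #S≤ : ∀ {β d} → IndepDiffs G (Side β) inK d → # S? ≤ suc (m (r ∸ (2 + d)))
    #S≤ {β} {d} (g , g∈ , ig) = order≤1+m G minimal S? S<n S-noTwins rank-S
      where
      f : Fin (d + 1) → Term n
      f = (diff G ∘ g) ⧺ (z ◂ ∅)
      rank-S : RankAtMost G S (r ∸ (2 + d))
      rank-S k x x∈ ix = subst (λ e → k ≤ r ∸ suc e) (ℕₚ.+-comm d 1) (rank-drop₁ G rank x x∈ ix f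
        (⧺-all (VanishesOn G S) (diff G ∘ g) (z ◂ ∅)
          (λ t j sj → row-diff-0 G (trans (side-S (proj₁ (g∈ t)) sj) (sym (side-S (proj₂ (g∈ t)) sj))))
          (λ { zero j sj → z-vanishes j (S⇒inK sj) }))
        (indep-⧺ (row G) {g = diff G ∘ g} {h = z ◂ ∅} (λ _ _ → tt) ig (λ { zero → z-vanishes })
          (λ c hyp → indep-single {φ = row G z} t₀ tt (z-T t₀∈T) c hyp))
        z (ι t₀) (λ j sj → z-vanishes j (S⇒inK sj))
        (⧺-all (λ s → ev z (row G s) ≡ 0ℚ) (diff G ∘ g) (z ◂ ∅)
          (λ t → cong₂ _-ℚ_
            (row-diff-0 G (trans (side-S (proj₁ (g∈ t)) u₀∈S) (sym (side-S (proj₂ (g∈ t)) u₀∈S))))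
            (row-diff-0 G (trans (side-C (proj₁ (g∈ t)) v₀∈C) (sym (side-C (proj₂ (g∈ t)) v₀∈C)))))
          (λ { zero → vanishes-ev G z z z-vanishes z-supp }))
        (λ eq → z-T t₀∈T (trans (ev-sym G (ι t₀) z) eq)))

    -- p and p′ are adjacent, so p − p′ is anisotropic; it is orthogonal to K.
    coincidence⇒rank : ∀ {β p p′} → Side β p → Side β p′ → p ≢ p′ → Same G inK p p′ → RankAtMost G inK (r ∸ 3)
    coincidence⇒rank {β} {p} {p′} sp sp′ p≢p′ same k x x∈ ix = rank-drop₁ G rank x x∈ ix (d ◂ z ◂ ∅)
      (λ { zero → d-vanishes ; (suc zero) → z-vanishes })
      (λ c hyp → indep-◂ {φ = row G d} {g = row G z ◂ ∅} d (supp-everywhere d) (norm adjacent)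
        (λ { zero → trans (ev-sym G d z) z⊥d }) (indep-single {φ = row G z} t₀ tt (z-T t₀∈T)) c hyp)
      z (ι t₀) z-vanishes (λ { zero → z⊥d ; (suc zero) → vanishes-ev G z z z-vanishes z-supp })
      (λ eq → z-T t₀∈T (trans (ev-sym G (ι t₀) z) eq))
      where
      d = ι p ⊖ ι p′
      d-vanishes : VanishesOn G inK d
      d-vanishes j j∈ = row-diff-0 G (same j j∈)
      z⊥d : ev z (row G d) ≡ 0ℚ
      z⊥d = ev-vanishes G z d z-supp d-vanishes
      -- If nonadjacent, they would differ in at least `τ` vertices, all of them in T but none equal
      -- to `p`.
      adjacent : adj G p p′ ≡ true
      adjacent with adj G p p′ in pp′
      ... | true  = refl
      ... | false = ⊥-elim (ℕₚ.<-irrefl refl (ℕₚ.≤-trans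
              (ℕₚ.+-mono-≤ (length≤# (p Finₚ.≟_) (p ∷ []) ([] ∷ []) (refl ∷ [])) (τ≤dist p≢p′ pp′))
              (ℕₚ.≤-trans (#-disjoint-≤ (p Finₚ.≟_) (diff? G p p′) T? (λ { i refl → proj₁ sp }) (λ i ne i∈ → ne (same i i∈))
                (λ { i refl ne → ne (trans (irrefl G p) (sym (trans (adj-sym G p′ p) pp′))) })) (ℕₚ.≤-reflexive #T))))
      norm : adj G p p′ ≡ true → ev d (row G d) ≢ 0ℚ
      norm e rewrite irrefl G p | irrefl G p′ | adj-sym G p′ p | e = λ ()

-- Numerical estimates

private
  infixl 5 _⊞_
  _⊞_ : ∀ {a b c d} → a ≤ b → c ≤ d → a + c ≤ b + d
  _⊞_ = ℕₚ.+-mono-≤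

  -- The pattern of all estimates: the hypotheses and the negated goal are added up by `_⊞_`, and a
  -- ring identity shows the left side to exceed the right by `suc d`.
  clash : ∀ {a b} d → a ≤ b → a ≡ suc d + b → ⊥
  clash {b = b} d a≤b refl = ℕₚ.<⇒≱ (s≤s (ℕₚ.m≤n+m b d)) a≤b

-- `s`, `c`, `h` are the sizes of `S`, `C`, `K₀`. With r the rank, `M`, `m₃`, `w`, `m₅`, `m₁` are
-- the values of `m` at r - 2, r - 3, r - 4, r - 5, r - 1.
module Estimates {n τ s c h M m₃ : ℕ} (large : 3 + 2 * M ≤ n) (order : n ≤ τ + (s + h)) (h≤M : h ≤ M) (gap : 6 + m₃ ≤ M) where

  order′ : n ≤ τ + (s + M)
  order′ = ℕₚ.≤-trans order (ℕₚ.+-monoʳ-≤ τ (ℕₚ.+-monoʳ-≤ s h≤M))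

  -- 17 is `2 ^ 4 + 1`, the size that guarantees five independent differences; likewise 9 in `9≤s`
  -- is `2 ^ 3 + 1`, for four.
  17≤s : τ ≤ m₃ → h ≤ m₃ → 17 + 2 * m₃ ≤ 3 + 2 * M → 17 ≤ s
  17≤s a b e = ℕₚ.≮⇒≥ λ s<17 → clash 0 (a ⊞ b ⊞ order ⊞ e ⊞ large ⊞ s<17)
    (solveℕ 6 (λ τ h n m M s → τ ⊕ h ⊕ n ⊕ (#c 17 ⊕ #c 2 ⊗ m) ⊕ (#c 3 ⊕ #c 2 ⊗ M) ⊕ (#c 1 ⊕ s)
      ≔ #c 1 ⊕ (m ⊕ m ⊕ (τ ⊕ (s ⊕ h)) ⊕ (#c 3 ⊕ #c 2 ⊗ M) ⊕ n ⊕ #c 17)) refl τ h n m₃ M s)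

  no-coincidence : ∀ {m₅} → τ ≤ m₅ → h ≤ m₃ → s ≤ suc c → c ≤ h → 2 + (m₅ + 2 * m₃) ≤ 3 + 2 * M → ⊥
  no-coincidence {m₅} a b d e f = clash 0 (a ⊞ b ⊞ b ⊞ d ⊞ e ⊞ order ⊞ f ⊞ large)
    (solveℕ 8 (λ τ h n m M s c k → τ ⊕ h ⊕ h ⊕ s ⊕ c ⊕ n ⊕ (#c 2 ⊕ (k ⊕ #c 2 ⊗ m)) ⊕ (#c 3 ⊕ #c 2 ⊗ M)
      ≔ #c 1 ⊕ (k ⊕ m ⊕ m ⊕ (#c 1 ⊕ c) ⊕ h ⊕ (τ ⊕ (s ⊕ h)) ⊕ (#c 3 ⊕ #c 2 ⊗ M) ⊕ n)) refl τ h n m₃ M s c m₅)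

  9≤s : τ ≤ m₃ → 9 ≤ s
  9≤s a = ℕₚ.≮⇒≥ λ s<9 → clash 0 (a ⊞ order′ ⊞ gap ⊞ large ⊞ s<9)
    (solveℕ 5 (λ τ n m M s → τ ⊕ n ⊕ (#c 6 ⊕ m) ⊕ (#c 3 ⊕ #c 2 ⊗ M) ⊕ (#c 1 ⊕ s)
      ≔ #c 1 ⊕ (m ⊕ (τ ⊕ (s ⊕ M)) ⊕ M ⊕ n ⊕ #c 9)) refl τ n m₃ M s)

  8≤τ : s ≤ suc m₃ → 8 ≤ τ
  8≤τ a = ℕₚ.≮⇒≥ λ τ<8 → clash 0 (a ⊞ order′ ⊞ gap ⊞ large ⊞ τ<8)
    (solveℕ 5 (λ τ n m M s → s ⊕ n ⊕ (#c 6 ⊕ m) ⊕ (#c 3 ⊕ #c 2 ⊗ M) ⊕ (#c 1 ⊕ τ)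
      ≔ #c 1 ⊕ (#c 1 ⊕ m ⊕ (τ ⊕ (s ⊕ M)) ⊕ M ⊕ n ⊕ #c 8)) refl τ n m₃ M s)

  both-small : ∀ {w} → τ ≤ w → s ≤ suc w → 2 + 2 * w ≤ M → ⊥
  both-small {w} a b d = clash 3 (a ⊞ b ⊞ order′ ⊞ d ⊞ large)
    (solveℕ 5 (λ τ n w M s → τ ⊕ s ⊕ n ⊕ (#c 2 ⊕ #c 2 ⊗ w) ⊕ (#c 3 ⊕ #c 2 ⊗ M)
      ≔ #c 4 ⊕ (w ⊕ (#c 1 ⊕ w) ⊕ (τ ⊕ (s ⊕ M)) ⊕ M ⊕ n)) refl τ n w M s)

  3≤τ : s ≤ c → c ≤ h → 3 ≤ τ
  3≤τ a b = ℕₚ.≮⇒≥ λ τ<3 → clash 0 (a ⊞ b ⊞ h≤M ⊞ h≤M ⊞ order ⊞ large ⊞ τ<3)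
    (solveℕ 6 (λ τ n h M s c → s ⊕ c ⊕ h ⊕ h ⊕ n ⊕ (#c 3 ⊕ #c 2 ⊗ M) ⊕ (#c 1 ⊕ τ)
      ≔ #c 1 ⊕ (c ⊕ h ⊕ M ⊕ M ⊕ (τ ⊕ (s ⊕ h)) ⊕ n ⊕ #c 3)) refl τ n h M s c)

  2≤τ : s ≤ suc c → c ≤ h → 2 ≤ τ
  2≤τ a b = ℕₚ.≮⇒≥ λ τ<2 → clash 0 (a ⊞ b ⊞ h≤M ⊞ h≤M ⊞ order ⊞ large ⊞ τ<2)
    (solveℕ 6 (λ τ n h M s c → s ⊕ c ⊕ h ⊕ h ⊕ n ⊕ (#c 3 ⊕ #c 2 ⊗ M) ⊕ (#c 1 ⊕ τ)
      ≔ #c 1 ⊕ (#c 1 ⊕ c ⊕ h ⊕ M ⊕ M ⊕ (τ ⊕ (s ⊕ h)) ⊕ n ⊕ #c 2)) refl τ n h M s c)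

  3+g≤2s : ∀ {g} → g + (τ + τ) ≤ n → 3 + g ≤ 2 * s
  3+g≤2s {g} a = ℕₚ.≮⇒≥ λ lt → clash 0 (a ⊞ order′ ⊞ order′ ⊞ large ⊞ lt)
    (solveℕ 5 (λ τ n M s g → g ⊕ (τ ⊕ τ) ⊕ n ⊕ n ⊕ (#c 3 ⊕ #c 2 ⊗ M) ⊕ (#c 1 ⊕ #c 2 ⊗ s)
      ≔ #c 1 ⊕ (n ⊕ (τ ⊕ (s ⊕ M)) ⊕ (τ ⊕ (s ⊕ M)) ⊕ n ⊕ (#c 3 ⊕ g))) refl τ n M s g)

  11≤τ : s ≤ 4 → 12 ≤ M → 11 ≤ τ
  11≤τ a b = ℕₚ.≮⇒≥ λ lt → clash 0 (order′ ⊞ a ⊞ b ⊞ large ⊞ lt)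
    (solveℕ 4 (λ τ n M s → n ⊕ s ⊕ #c 12 ⊕ (#c 3 ⊕ #c 2 ⊗ M) ⊕ (#c 1 ⊕ τ)
      ≔ #c 1 ⊕ ((τ ⊕ (s ⊕ M)) ⊕ #c 4 ⊕ M ⊕ n ⊕ #c 11)) refl τ n M s)

  d≤10 : ∀ {d g g′} → d ≤ g + g′ → 3 + g ≤ 2 * s → 3 + g′ ≤ 2 * s → s ≤ 4 → d ≤ 10
  d≤10 {d} {g} {g′} a b b′ e = ℕₚ.≮⇒≥ λ lt → clash 0 (a ⊞ b ⊞ b′ ⊞ e ⊞ e ⊞ e ⊞ e ⊞ lt)
    (solveℕ 4 (λ d g h s → d ⊕ (#c 3 ⊕ g) ⊕ (#c 3 ⊕ h) ⊕ s ⊕ s ⊕ s ⊕ s ⊕ #c 11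
      ≔ #c 1 ⊕ (g ⊕ h ⊕ #c 2 ⊗ s ⊕ #c 2 ⊗ s ⊕ #c 4 ⊕ #c 4 ⊕ #c 4 ⊕ #c 4 ⊕ d)) refl d g g′ s)

  no-close : ∀ {x d m₁} → x ≤ suc m₁ → d ≤ 10 → n ≤ x + d → 12 + m₁ ≤ 3 + 2 * M → ⊥
  no-close {x} {d} {m₁} a b e f = clash 0 (a ⊞ b ⊞ e ⊞ f ⊞ large)
    (solveℕ 5 (λ x d m M n → x ⊕ d ⊕ n ⊕ (#c 12 ⊕ m) ⊕ (#c 3 ⊕ #c 2 ⊗ M)
      ≔ #c 1 ⊕ (#c 1 ⊕ m ⊕ #c 10 ⊕ (x ⊕ d) ⊕ (#c 3 ⊕ #c 2 ⊗ M) ⊕ n)) refl x d m₁ M n)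

  τ-lower : ∀ d → 3 ≡ d + s → M + d ≤ τ
  τ-lower d eq = ℕₚ.≮⇒≥ λ lt → clash 0 (order′ ⊞ large ⊞ lt ⊞ ℕₚ.≤-reflexive (sym eq))
    (solveℕ 5 (λ τ n M s d → n ⊕ (#c 3 ⊕ #c 2 ⊗ M) ⊕ (#c 1 ⊕ τ) ⊕ (d ⊕ s)
      ≔ #c 1 ⊕ ((τ ⊕ (s ⊕ M)) ⊕ n ⊕ (M ⊕ d) ⊕ #c 3)) refl τ n M s d)

-- With r = 5 + `ρ`, the values of `m` at r - 1, r - 2 and r - 3 are affine in `x`, its value at r -
-- 5, and `w`, its value at r - 4; the gaps reduce to comparing these two.
module Ranks {ρ} (5≤ρ : 5 ≤ ρ) where
  private
    x = m ρ
    w = m (1 + ρ)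
    g₁ = proj₁ (m-gap 5≤ρ)
    g₂ = proj₂ (m-gap 5≤ρ)
    2≤ρ : 2 ≤ ρ
    2≤ρ = ℕₚ.≤-trans (s≤s (s≤s z≤n)) 5≤ρ
    e₃ : m (2 + ρ) ≡ 2 + 2 * x
    e₃ = m-step 2≤ρ
    e₁ : m (4 + ρ) ≡ 2 + 2 * (2 + 2 * x)
    e₁ = trans (m-step (ℕₚ.m≤n⇒m≤1+n (ℕₚ.m≤n⇒m≤1+n 2≤ρ))) (cong (λ y → 2 + 2 * y) e₃)

  e₂ : m (3 + ρ) ≡ 2 + 2 * w
  e₂ = m-step (ℕₚ.m≤n⇒m≤1+n 2≤ρ)

  gap₁₇ : 17 + 2 * m (2 + ρ) ≤ 3 + 2 * m (3 + ρ)
  gap₁₇ rewrite e₃ | e₂ = ℕₚ.≮⇒≥ λ lt → clash 2 (g₁ ⊞ g₁ ⊞ g₁ ⊞ g₁ ⊞ lt)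
    (solveℕ 2 (λ x w → #c 4 ⊕ x ⊕ (#c 4 ⊕ x) ⊕ (#c 4 ⊕ x) ⊕ (#c 4 ⊕ x) ⊕ (#c 1 ⊕ (#c 3 ⊕ #c 2 ⊗ (#c 2 ⊕ #c 2 ⊗ w)))
      ≔ #c 3 ⊕ (w ⊕ w ⊕ w ⊕ w ⊕ (#c 17 ⊕ #c 2 ⊗ (#c 2 ⊕ #c 2 ⊗ x)))) refl x w)

  gap₂ : 2 + (m ρ + 2 * m (2 + ρ)) ≤ 3 + 2 * m (3 + ρ)
  gap₂ rewrite e₃ | e₂ = ℕₚ.≮⇒≥ λ lt → clash 3 (g₂ ⊞ lt)
    (solveℕ 2 (λ x w → #c 2 ⊕ #c 5 ⊗ x ⊕ (#c 1 ⊕ (#c 3 ⊕ #c 2 ⊗ (#c 2 ⊕ #c 2 ⊗ w)))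
      ≔ #c 4 ⊕ (#c 4 ⊗ w ⊕ (#c 2 ⊕ (x ⊕ #c 2 ⊗ (#c 2 ⊕ #c 2 ⊗ x))))) refl x w)

  gap₆ : 6 + m (2 + ρ) ≤ m (3 + ρ)
  gap₆ rewrite e₃ | e₂ = ℕₚ.≮⇒≥ λ lt → clash 2 (g₁ ⊞ g₁ ⊞ lt)
    (solveℕ 2 (λ x w → #c 4 ⊕ x ⊕ (#c 4 ⊕ x) ⊕ (#c 1 ⊕ (#c 2 ⊕ #c 2 ⊗ w))
      ≔ #c 3 ⊕ (w ⊕ w ⊕ (#c 6 ⊕ (#c 2 ⊕ #c 2 ⊗ x)))) refl x w)

  gap₁₂ : 12 + m (4 + ρ) ≤ 3 + 2 * m (3 + ρ)
  gap₁₂ rewrite e₁ | e₂ = ℕₚ.≮⇒≥ λ lt → clash 5 (g₁ ⊞ g₁ ⊞ g₁ ⊞ g₁ ⊞ lt)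
    (solveℕ 2 (λ x w → #c 4 ⊕ x ⊕ (#c 4 ⊕ x) ⊕ (#c 4 ⊕ x) ⊕ (#c 4 ⊕ x) ⊕ (#c 1 ⊕ (#c 3 ⊕ #c 2 ⊗ (#c 2 ⊕ #c 2 ⊗ w)))
      ≔ #c 6 ⊕ (w ⊕ w ⊕ w ⊕ w ⊕ (#c 12 ⊕ (#c 2 ⊕ #c 2 ⊗ (#c 2 ⊕ #c 2 ⊗ x))))) refl x w)

  12≤M : 12 ≤ m (3 + ρ)
  12≤M rewrite e₂ = ℕₚ.≮⇒≥ λ lt → clash 2 (g₁ ⊞ g₁ ⊞ m-mono {2} ℕₚ.≤-refl 2≤ρ ⊞ m-mono {2} ℕₚ.≤-refl 2≤ρ ⊞ lt)
    (solveℕ 2 (λ x w → #c 4 ⊕ x ⊕ (#c 4 ⊕ x) ⊕ #c 2 ⊕ #c 2 ⊕ (#c 1 ⊕ (#c 2 ⊕ #c 2 ⊗ w))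
      ≔ #c 3 ⊕ (w ⊕ w ⊕ x ⊕ x ⊕ #c 12)) refl x w)

-- The size of S, its completeness, and the three cases

5≤2s⇒3≤s : ∀ {s} → 5 ≤ 2 * s → 3 ≤ s
5≤2s⇒3≤s 5≤2s = ℕₚ.≮⇒≥ λ s<3 → ℕₚ.<⇒≱ 5≤2s (ℕₚ.*-monoʳ-≤ 2 (ℕₚ.≤-pred s<3))

module Casework {n ρ} (5≤ρ : 5 ≤ ρ) (G : Graph n) (red : Reduced G) (rank : HasRank G (5 + ρ)) (minimal : MinimalCounterexampleOrder n)
  (large : 3 + 2 * m (3 + ρ) ≤ n) {τ} (isτ : IsTau G τ) (K : Subset n) (∣K∣≡ : ∣ K ∣ ≡ n ∸ τ)
  {rH} (rankK : RankOn G K rH) (r∸3≤rH : 2 + ρ ≤ rH) where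

  open Structure G red rank minimal large isτ K ∣K∣≡ rankK r∸3≤rH public
  open Ranks 5≤ρ

  module Conclusion (u₀ v₀ : Fin n) (tw₀ : Twin u₀ v₀) (oriented : ∀ w → IsoK w → Same G T w u₀) where

    open Oriented u₀ v₀ tw₀ oriented public
    open Estimates {τ = τ} {s = # S?} {c = # C?} large n≤τ+S+K₀ (#K₀≤ rank-K) gap₆

    S-distinct : ∀ a b → S a → S b → Same G Everywhere a b → a ≡ b
    S-distinct a b _ _ same = proj₂ red a b (λ k → same k tt)

    S-diffs : ∀ f → 2 ^ f < # S? → IndepDiffs G S Everywhere (suc f)
    S-diffs f = indepDiffs G f S? (λ _ → yes tt) S-distinct

    φ≤r : ∀ {φ} → φ ≤ 6 → 4 + φ ≤ 5 + ρ
    φ≤r φ≤6 = ℕₚ.≤-trans (ℕₚ.+-monoʳ-≤ 4 φ≤6) (ℕₚ.+-monoʳ-≤ 5 5≤ρ)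

    halve : ∀ k → k + k < τ → ∃ λ β → k < # (side? β)
    halve k lt with k ℕₚ.<? # (side? true) | k ℕₚ.<? # (side? false)
    ... | yes a | _     = true , a
    ... | no _  | yes b = false , b
    ... | no ¬a | no ¬b = contradiction (ℕₚ.≤-trans (ℕₚ.≤-reflexive (sym #T)) (ℕₚ.≤-trans
            (#-∪-≤ (side? true) (side? false) T? both) (ℕₚ.+-mono-≤ (ℕₚ.≮⇒≥ ¬a) (ℕₚ.≮⇒≥ ¬b)))) (ℕₚ.<⇒≱ lt)
      where
      both : ∀ t → T t → Side true t ⊎ Side false t
      both t t∉ with adj G u₀ t
      ... | true  = inj₁ (t∉ , refl)
      ... | false = inj₂ (t∉ , refl)

    -- An isolated vertex of K forces all of T onto one side, so two vertices of T suffice. Without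
    -- one, |S| ≤ |C|, which yields a third vertex of T and the pigeonhole principle applies.
    two-on-a-side : ∃ λ β → 1 < # (side? β)
    two-on-a-side with Finₚ.any? isoK?
    ... | no none = halve 1 (3≤τ (ℕₚ.≤-trans #S≤#C+#Iso (ℕₚ.≤-reflexive (trans (cong (# C? +_) iso≡0) (ℕₚ.+-identityʳ _)))) #C≤#K₀)
      where
      iso≡0 : # isoK? ≡ 0
      iso≡0 = ℕₚ.n≤0⇒n≡0 (#-≤length isoK? [] (λ i iso → ⊥-elim (none (i , iso))))
    ... | yes (w , iso) = true , ℕₚ.≤-trans (2≤τ #S≤1+#C #C≤#K₀) (ℕₚ.≤-trans (ℕₚ.≤-reflexive (sym #T))
            (#-mono T? (side? true) (λ t t∉ → t∉ , trans (sym (oriented w iso t t∉)) (isolated-T (proj₁ iso) (proj₂ iso) t t∉))))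

    Coincident : Fin n → Fin n → Set
    Coincident p q = T p × T q × adj G u₀ p ≡ adj G u₀ q × p ≢ q × Same G inK p q

    coincident? : ∀ p q → Dec (Coincident p q)
    coincident? p q = T? p ×-dec (T? q ×-dec ((adj G u₀ p Boolₚ.≟ adj G u₀ q) ×-dec (¬? (p Finₚ.≟ q) ×-dec same? G inK? p q)))

    -- Three differences give τ ≤ m(r - 3); the order then forces more vertices into `S`, hence more
    -- differences. The dichotomy is whether two vertices on one side of T coincide on K. If so, K
    -- loses rank and T, `S`, `K₀` are all too small; if not, each side supplies differences on K
    -- that bound `S`.
    three-indep⇒⊥ : ¬ IndepDiffs G S Everywhere 3
    three-indep⇒⊥ D with Finₚ.any? (λ p → Finₚ.any? (coincident? p))
    ... | yes (p , q , p∉ , q∉ , e , p≢q , same) = no-coincidence τ≤m₅ K₀≤ #S≤1+#C #C≤#K₀ gap₂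
      where
      K₀≤ : # K₀? ≤ m (2 + ρ)
      K₀≤ = #K₀≤ (coincidence⇒rank (p∉ , refl) (q∉ , sym e) p≢q same)
      τ≤m₅ : τ ≤ m ρ
      τ≤m₅ = τ≤m (S-diffs 4 (17≤s (τ≤m D (φ≤r (s≤s (s≤s (s≤s z≤n))))) K₀≤ gap₁₇)) (φ≤r (s≤s (s≤s (s≤s (s≤s (s≤s z≤n))))))
    ... | no none = both-small τ≤m₄ (#S≤ (side-diffs 1 (proj₂ three))) (ℕₚ.≤-reflexive (sym e₂))
      where
      τ≤m₄ : τ ≤ m (1 + ρ)
      τ≤m₄ = τ≤m (S-diffs 3 (9≤s (τ≤m D (φ≤r (s≤s (s≤s (s≤s z≤n))))))) (φ≤r (s≤s (s≤s (s≤s (s≤s z≤n)))))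
      side-diffs : ∀ {β} f → 2 ^ f < # (side? β) → IndepDiffs G (Side β) inK (suc f)
      side-diffs f = indepDiffs G f (side? _) inK? λ p q (p∉ , e) (q∉ , e′) same →
        decidable-stable (p Finₚ.≟ q) λ p≢q → none (p , q , p∉ , q∉ , trans e (sym e′) , p≢q , same)
      -- Two vertices on a side bound |S| by 1 + m(r - 3), which makes `τ` large enough for three on
      -- a side; these give two differences and |S| ≤ 1 + m(r - 4).
      three : ∃ λ β → 2 < # (side? β)
      three = halve 2 (ℕₚ.≤-trans (s≤s (s≤s (s≤s (s≤s (s≤s z≤n))))) (8≤τ (#S≤ (side-diffs 0 (proj₂ two-on-a-side)))))

    S≤4 : # S? ≤ 4
    S≤4 = ℕₚ.≮⇒≥ λ lt → three-indep⇒⊥ (S-diffs 2 lt)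

    Agree : Fin n → Fin n → Fin n → Set
    Agree a b k = inK k × adj G a k ≡ adj G b k

    agree? : ∀ a b → Decidable (Agree a b)
    agree? a b k = inK? k ×-dec (adj G a k Boolₚ.≟ adj G b k)

    -- All of `S` agrees on T, so the at least `τ` differences lie in K and leave at most `n - 2τ`
    -- agreements there. From `τ ≥ n - |S| - M` and `n ≥ 2M + 3` this is at most `2|S| - 3`.
    #Agree : ∀ {a b} → S a → S b → a ≢ b → adj G a b ≡ false → 3 + # (agree? a b) ≤ 2 * # S?
    #Agree {a} {b} sa sb a≢b ab = 3+g≤2s (begin
      # (agree? a b) + (τ + τ)
        ≤⟨ ℕₚ.+-monoʳ-≤ (# (agree? a b)) (ℕₚ.+-monoˡ-≤ τ (τ≤dist a≢b ab)) ⟩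
      # (agree? a b) + (# (diff? G a b) + τ)
        ≡⟨ sym (ℕₚ.+-assoc (# (agree? a b)) _ τ) ⟩
      # (agree? a b) + # (diff? G a b) + τ
        ≤⟨ ℕₚ.+-monoˡ-≤ τ (#-disjoint-≤ (agree? a b) (diff? G a b) inK? (λ _ → proj₁) in-K (λ _ (_ , e) ne → ne e)) ⟩
      # inK? + τ
        ≡⟨ trans (cong (# inK? +_) (sym #T)) (#-compl inK?) ⟩
      n ∎)
      where
      open ℕₚ.≤-Reasoning
      in-K : ∀ k → Diff G a b k → inK k
      in-K k ne = decidable-stable (inK? k) λ k∉ → ne (trans (proj₂ sa k k∉) (sym (proj₂ sb k k∉)))

    -- a and c both nearly complement b on K, hence nearly agree.
    no-cherry : ∀ {a b c} → S a → S b → S c → a ≢ b → c ≢ b → a ≢ c → adj G a b ≡ false → adj G c b ≡ false → ⊥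
    no-cherry {a} {b} {c} sa sb sc a≢b c≢b a≢c ab cb =
      -- On the vertices where `a` and `c` agree the rank is at most r - 1, and there are no twins
      -- because fewer than `τ` vertices are missing. At most 10 = 2 · (2 · 4 - 3) are missing, too
      -- few to bring `n` down to 1 + m(r - 1).
      no-close (order≤1+m G minimal X? X<n (removed<τ⇒noTwins X? (ℕₚ.≤-trans (s≤s close) (11≤τ S≤4 12≤M))) rank-X)
        close (ℕₚ.≤-reflexive (sym (#-compl X?))) gap₁₂
      where
      X? : Decidable (λ k → adj G a k ≡ adj G c k)
      X? k = adj G a k Boolₚ.≟ adj G c k
      close : # (diff? G a c) ≤ 10
      close = d≤10 (#-∪-≤ (agree? a b) (agree? c b) (diff? G a c) split) (#Agree sa sb a≢b ab) (#Agree sc sb c≢b cb) S≤4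
        where
        split : ∀ k → Diff G a c k → Agree a b k ⊎ Agree c b k
        split k ne with adj G a k Boolₚ.≟ adj G b k
        ... | yes e = inj₁ (k∈ , e)
          where k∈ = decidable-stable (inK? k) λ k∉ → ne (trans (proj₂ sa k k∉) (sym (proj₂ sc k k∉)))
        ... | no ne′ = inj₂ (k∈ , bool-≢-≢ {b = adj G a k} (ne ∘ sym) (ne′ ∘ sym))
          where k∈ = decidable-stable (inK? k) λ k∉ → ne (trans (proj₂ sa k k∉) (sym (proj₂ sc k k∉)))
      y = reduced-differ G red a≢c
      X<n : # X? < n
      X<n = #-∁-< X? (proj₁ y) (proj₂ y)
      rank-X : RankAtMost G (λ k → adj G a k ≡ adj G c k) (4 + ρ)
      rank-X k x x∈ ix = rank-drop₀ G rank x ix ((ι a ⊖ ι c) ◂ ∅) (λ { zero j e → row-diff-0 G e })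
        (λ d hyp → indep-single {φ = row G (ι a ⊖ ι c)} (proj₁ y) tt (row-diff-≢0 G (proj₂ y)) d hyp)

    -- An isolated `w` agrees with `u₀` on `u₀`, `v₀` and `w`, so `#Agree` yields |S| ≥ 3. Since `w`
    -- is adjacent to nothing in `S`, a third vertex contradicts `no-cherry`.
    noIso : ∀ w → ¬ IsoK w
    noIso w (w∈ , iso) = no-cherry u₀∈S sw (proj₁ (proj₂ third)) u₀≢w (λ e → proj₂ (proj₂ third) (there (here e)))
        (λ e → proj₂ (proj₂ third) (here (sym e))) (flip u₀∈S) (flip (proj₁ (proj₂ third)))
      where
      sw : S w
      sw = inj₂ (w∈ , iso) , oriented w (w∈ , iso)
      flip : ∀ {k} → S k → adj G k w ≡ false
      flip {k} sk = trans (adj-sym G k w) (iso k (S⇒inK sk))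
      u₀≢w : u₀ ≢ w
      u₀≢w refl = dup⇒¬iso (v₀ , tw₀) (w∈ , iso)
      v₀≢w : v₀ ≢ w
      v₀≢w refl = dup⇒¬iso (u₀ , twin-sym tw₀) (w∈ , iso)
      agreement : 3 ≤ # (agree? u₀ w)
      agreement = length≤# (agree? u₀ w) (u₀ ∷ v₀ ∷ w ∷ [])
        ((proj₁ (proj₂ (proj₂ tw₀)) ∷ u₀≢w ∷ []) ∷ (v₀≢w ∷ []) ∷ [] ∷ [])
        ((proj₁ tw₀ , trans (irrefl G u₀) (sym (iso u₀ (proj₁ tw₀))))
          ∷ (proj₁ (proj₂ tw₀) , trans (trans (twin-adj (twin-sym tw₀) (proj₁ tw₀)) (irrefl G u₀)) (sym (iso v₀ (proj₁ (proj₂ tw₀)))))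
          ∷ (w∈ , trans (flip u₀∈S) (sym (irrefl G w))) ∷ [])
      third : ∃ λ c → S c × c ∉ₗ u₀ ∷ w ∷ []
      third = pick S? (u₀ ∷ w ∷ []) (5≤2s⇒3≤s (ℕₚ.≤-trans (ℕₚ.n≤1+n 5) (ℕₚ.≤-trans (ℕₚ.+-monoʳ-≤ 3 agreement) (#Agree u₀∈S sw u₀≢w (flip u₀∈S)))))

    S⇒Dup : ∀ {k} → S k → Dup k
    S⇒Dup (inj₁ d , _) = d
    S⇒Dup (inj₂ i , _) = ⊥-elim (noIso _ i)

    twins-distinct : ∀ {a b a′ b′} → S a → S b → a ≢ b → Twin a a′ → Twin b b′ → a′ ≢ b′
    twins-distinct sa sb a≢b ta tb refl = a≢b (agree⇒≡
      (λ w w∈ → trans (proj₂ (proj₂ (proj₂ ta)) w w∈) (sym (proj₂ (proj₂ (proj₂ tb)) w w∈)))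
      (λ t t∉ → trans (proj₂ sa t t∉) (sym (proj₂ sb t t∉))))

    S≢C : ∀ {a b} → S a → C b → a ≢ b
    S≢C sa cb refl = S∩K₀ _ sa (inj₁ cb)

    -- A nonadjacent pair agrees on itself and on its two twins, so |S| ≥ 3. By `no-cherry` a third
    -- vertex of `S` is adjacent to both; it and its twin make six agreements, and 3 + 6 exceeds 2 ·
    -- 4.
    no-nonadjacent : ∀ {a b} → S a → S b → a ≢ b → Dup a → Dup b → adj G a b ≢ false
    no-nonadjacent {a} {b} sa sb a≢b (a′ , ta) (b′ , tb) ab = absurd third
      where
      ba : adj G b a ≡ false
      ba = trans (adj-sym G b a) ab
      in-a : Agree a b a
      in-a = S⇒inK sa , trans (irrefl G a) (sym ba)
      in-b : Agree a b b
      in-b = S⇒inK sb , trans ab (sym (irrefl G b))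
      in-twin : ∀ {k k′} → Twin k k′ → Agree a b k → Agree a b k′
      in-twin tw (_ , e) = proj₁ (proj₂ tw) , trans (sym (twin-adj tw (S⇒inK sa))) (trans e (twin-adj tw (S⇒inK sb)))
      ca = twin-of-S ta (proj₂ sa)
      cb = twin-of-S tb (proj₂ sb)
      four : 4 ≤ # (agree? a b)
      four = length≤# (agree? a b) (a ∷ b ∷ a′ ∷ b′ ∷ [])
        ((a≢b ∷ S≢C sa ca ∷ S≢C sa cb ∷ []) ∷ (S≢C sb ca ∷ S≢C sb cb ∷ []) ∷ (twins-distinct sa sb a≢b ta tb ∷ []) ∷ [] ∷ [])
        (in-a ∷ in-b ∷ in-twin ta in-a ∷ in-twin tb in-b ∷ [])
      third : ∃ λ c → S c × c ∉ₗ a ∷ b ∷ []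
      third = pick S? (a ∷ b ∷ []) (5≤2s⇒3≤s (ℕₚ.≤-trans (ℕₚ.m≤n+m 5 2) (ℕₚ.≤-trans (ℕₚ.+-monoʳ-≤ 3 four) (#Agree sa sb a≢b ab))))
      module _ {c} (sc : S c) (c≢a : c ≢ a) (c≢b : c ≢ b) where
        common : Dup c → adj G c a ≡ true → adj G c b ≡ true → ⊥
        common (c′ , tc) ca₀ cb₀ = ℕₚ.<⇒≱ {8} ℕₚ.≤-refl
          (ℕₚ.≤-trans (ℕₚ.+-monoʳ-≤ 3 six) (ℕₚ.≤-trans (#Agree sa sb a≢b ab) (ℕₚ.*-monoʳ-≤ 2 S≤4)))
          where
          in-c : Agree a b c
          in-c = S⇒inK sc , trans (trans (adj-sym G a c) ca₀) (sym (trans (adj-sym G b c) cb₀))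
          cc = twin-of-S tc (proj₂ sc)
          six : 6 ≤ # (agree? a b)
          six = length≤# (agree? a b) (a ∷ b ∷ c ∷ a′ ∷ b′ ∷ c′ ∷ [])
            ( (a≢b ∷ (c≢a ∘ sym) ∷ S≢C sa ca ∷ S≢C sa cb ∷ S≢C sa cc ∷ [])
            ∷ ((c≢b ∘ sym) ∷ S≢C sb ca ∷ S≢C sb cb ∷ S≢C sb cc ∷ [])
            ∷ (S≢C sc ca ∷ S≢C sc cb ∷ S≢C sc cc ∷ [])
            ∷ (twins-distinct sa sb a≢b ta tb ∷ twins-distinct sa sc (c≢a ∘ sym) ta tc ∷ [])
            ∷ (twins-distinct sb sc (c≢b ∘ sym) tb tc ∷ []) ∷ [] ∷ [])
            (in-a ∷ in-b ∷ in-c ∷ in-twin ta in-a ∷ in-twin tb in-b ∷ in-twin tc in-c ∷ [])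
        adjacent-a : adj G c a ≢ false
        adjacent-a ca₀ = no-cherry sb sa sc (a≢b ∘ sym) c≢a (c≢b ∘ sym) ba ca₀
        adjacent-b : adj G c b ≢ false
        adjacent-b cb₀ = no-cherry sa sb sc a≢b c≢b (c≢a ∘ sym) ab cb₀
      absurd : (∃ λ c → S c × c ∉ₗ a ∷ b ∷ []) → ⊥
      absurd (c , sc , c∉) = common sc c≢a c≢b (S⇒Dup sc)
        (Boolₚ.¬-not (adjacent-a sc c≢a c≢b)) (Boolₚ.¬-not (adjacent-b sc c≢a c≢b))
        where
        c≢a : c ≢ a
        c≢a e = c∉ (here e)
        c≢b : c ≢ b
        c≢b e = c∉ (there (here e))

    complete : ∀ {a b} → S a → S b → a ≢ b → adj G a b ≡ true
    complete sa sb a≢b = Boolₚ.¬-not (no-nonadjacent sa sb a≢b (S⇒Dup sa) (S⇒Dup sb))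

    -- Within a clique two rows differ only at their own two vertices, so the columns `b`, `d`, `c`,
    -- in this order, make the family triangular.
    clique-indep : ∀ {a b c d} → S a → S b → S c → S d → a ≢ b → a ≢ c → a ≢ d → b ≢ c → b ≢ d → c ≢ d →
      IndepDiffs G S Everywhere 3
    clique-indep {a} {b} {c} {d} sa sb sc sd ab ac ad bc bd cd = g , g∈ , λ x hyp →
      indep-◂ {φ = row G (ι a ⊖ ι b)} {g = row G (ι c ⊖ ι d) ◂ row G (ι a ⊖ ι c) ◂ ∅} (ι b) tt
        (row-diff-≢0 G (edge≢loop sa sb ab))
        (λ { zero → row-diff-0 G (both sc sd sb (bc ∘ sym) (bd ∘ sym)) ; (suc zero) → row-diff-0 G (both sa sc sb ab (bc ∘ sym)) })
        (indep-◂ {φ = row G (ι c ⊖ ι d)} {g = row G (ι a ⊖ ι c) ◂ ∅} (ι d) tt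
          (row-diff-≢0 G (edge≢loop sc sd cd)) (λ { zero → row-diff-0 G (both sa sc sd ad cd) })
          (indep-single {φ = row G (ι a ⊖ ι c)} c tt (row-diff-≢0 G (edge≢loop sa sc ac)))) x hyp
      where
      g : Fin 3 → Fin n × Fin n
      g = (a , b) ◂ (c , d) ◂ (a , c) ◂ ∅
      g∈ : ∀ t → S (proj₁ (g t)) × S (proj₂ (g t))
      g∈ zero             = sa , sb
      g∈ (suc zero)       = sc , sd
      g∈ (suc (suc zero)) = sa , sc
      both : ∀ {i j k} → S i → S j → S k → i ≢ k → j ≢ k → adj G i k ≡ adj G j k
      both si sj sk i≢k j≢k = trans (complete si sk i≢k) (sym (complete sj sk j≢k))
      edge≢loop : ∀ {i j} → S i → S j → i ≢ j → adj G i j ≢ adj G j j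
      edge≢loop {i} {j} si sj i≢j eq = Boolₚ.not-¬ (complete si sj i≢j) (trans eq (irrefl G j))

    S≤3 : # S? ≤ 3
    S≤3 = ℕₚ.≮⇒≥ λ lt → four (pick S? [] (ℕₚ.≤-trans (s≤s z≤n) lt)) lt
      where
      four : (∃ λ a → S a × a ∉ₗ []) → 3 < # S? → ⊥
      four (a , sa , _) lt
        with b , sb , b∉ ← pick S? (a ∷ []) (ℕₚ.≤-trans (s≤s (s≤s z≤n)) lt)
        with c , sc , c∉ ← pick S? (b ∷ a ∷ []) (ℕₚ.≤-trans (s≤s (s≤s (s≤s z≤n))) lt)
        with d , sd , d∉ ← pick S? (c ∷ b ∷ a ∷ []) lt =
        three-indep⇒⊥ (clique-indep sa sb sc sd (λ e → b∉ (here (sym e))) (λ e → c∉ (there (here (sym e))))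
          (λ e → d∉ (there (there (here (sym e))))) (λ e → c∉ (here (sym e))) (λ e → d∉ (there (here (sym e)))) (λ e → d∉ (here (sym e))))

    -- Since `2 ^ 1 < 3`, three vertices of `S` have two independent differences.
    #S≡3⇒τ≤M : # S? ≡ 3 → τ ≤ m (3 + ρ)
    #S≡3⇒τ≤M eq = τ≤m (S-diffs 1 (ℕₚ.≤-reflexive (sym eq))) (φ≤r (s≤s (s≤s z≤n)))

    module _ (R : Subset n) (reps : Representatives G K R) where

      private
        R⇒Dup : ∀ {k} → k ∈ R → Dup k
        R⇒Dup k∈R with k∈ , v , v∈ , k≢v , same ← proj₁ reps _ k∈R = v , k∈ , v∈ , k≢v , same

      -- `R` may choose its representatives on either side of T; passing to the twin changes no
      -- adjacency to K.
      toS : ∀ k → k ∈ R → ∃ λ s → S s × Same G inK k s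
      toS k k∈R with v , tw ← R⇒Dup k∈R with twin-side tw
      ... | inj₁ su = k , (inj₁ (v , tw) , su) , λ _ _ → refl
      ... | inj₂ sv = v , twin-of-C tw sv , proj₂ (proj₂ (proj₂ tw))

      toS-injective : ∀ {i j} (p : i ∈ R) (q : j ∈ R) → proj₁ (toS i p) ≡ proj₁ (toS j q) → i ≡ j
      toS-injective {i} {j} p q eq = proj₂ (proj₂ reps) i j p q λ w w∈ →
        trans (proj₂ (proj₂ (toS i p)) w w∈) (trans (cong (λ s → adj G s w) eq) (sym (proj₂ (proj₂ (toS j q)) w w∈)))

      toR : ∀ k → S k → ∃ λ v → v ∈ R × Same G inK k v
      toR k sk with v , k∈ , v∈ , k≢v , same ← S⇒Dup sk = proj₁ (proj₂ reps) k k∈ (v , v∈ , k≢v , same)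

      ∣R∣≡#S : ∣ R ∣ ≡ # S?
      ∣R∣≡#S = trans (sym (#∈≡∣∣ R)) (ℕₚ.≤-antisym
        (#-inject (_∈? R) S? (λ k p → proj₁ (toS k p)) (λ k p → proj₁ (proj₂ (toS k p))) (λ i p j q → toS-injective p q))
        (#-inject S? (_∈? R) (λ k s → proj₁ (toR k s)) (λ k s → proj₁ (proj₂ (toR k s))) λ i si j sj eq → agree⇒≡
          (λ w w∈ → trans (proj₂ (proj₂ (toR i si)) w w∈) (trans (cong (λ v → adj G v w) eq) (sym (proj₂ (proj₂ (toR j sj)) w w∈))))
          (λ t t∉ → trans (proj₂ si t t∉) (sym (proj₂ sj t t∉)))))

      R-complete : ∀ u v → u ∈ R → v ∈ R → u ≢ v → adj G u v ≡ true
      R-complete u v u∈R v∈R u≢v = begin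
        adj G u v  ≡⟨ proj₂ (proj₂ (toS u u∈R)) v (dup⇒inK (R⇒Dup v∈R)) ⟩
        adj G a v  ≡⟨ adj-sym G a v ⟩
        adj G v a  ≡⟨ proj₂ (proj₂ (toS v v∈R)) a (S⇒inK (proj₁ (proj₂ (toS u u∈R)))) ⟩
        adj G b a  ≡⟨ complete (proj₁ (proj₂ (toS v v∈R))) (proj₁ (proj₂ (toS u u∈R)))
                        (λ b≡a → u≢v (toS-injective u∈R v∈R (sym b≡a))) ⟩
        true       ∎
        where
        open ≡-Reasoning
        a = proj₁ (toS u u∈R)
        b = proj₁ (toS v v∈R)

      conclusion : (IsoComplete G R 1 × m (3 + ρ) + 2 ≤ τ) ⊎ (IsoComplete G R 2 × m (3 + ρ) + 1 ≤ τ) ⊎ (IsoComplete G R 3 × τ ≡ m (3 + ρ))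
      conclusion = cases (# S?) refl S≤3
        where
        cases : ∀ k → # S? ≡ k → k ≤ 3 → _
        cases zero e _ = ⊥-elim (ℕₚ.<⇒≱ (length≤# S? (u₀ ∷ []) ([] ∷ []) (u₀∈S ∷ [])) (ℕₚ.≤-reflexive e))
        -- The lower bounds are `τ + |S| ≥ M + 3`, a consequence of `2M + 3 ≤ n ≤ τ + |S| + M`.
        cases 1 e _ = inj₁ ((trans ∣R∣≡#S e , R-complete) , τ-lower 2 (cong (2 +_) (sym e)))
        cases 2 e _ = inj₂ (inj₁ ((trans ∣R∣≡#S e , R-complete) , τ-lower 1 (cong (1 +_) (sym e))))
        cases 3 e _ = inj₂ (inj₂ ((trans ∣R∣≡#S e , R-complete) ,
          ℕₚ.≤-antisym (#S≡3⇒τ≤M e) (subst (_≤ τ) (ℕₚ.+-identityʳ _) (τ-lower 0 (sym e)))))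
        cases (suc (suc (suc (suc _)))) _ (s≤s (s≤s (s≤s ())))

  -- If K has an isolated vertex, one of the two twins is, like it, adjacent to all of T, and that
  -- twin is taken as `u₀`. Otherwise the condition is vacuous.
  orientation : ∀ {u v} → Twin u v → ∃ λ u₀ → ∃ λ v₀ → Twin u₀ v₀ × (∀ w → IsoK w → Same G T w u₀)
  orientation {u} {v} tw with Finₚ.any? isoK?
  ... | no none = u , v , tw , λ w iso → ⊥-elim (none (w , iso))
  ... | yes (w , w∈ , iso) = choose (adj G u t₀ Boolₚ.≟ true)
    where
    open Pair u v tw
    module Swapped = Pair v u (twin-sym tw)
    choose : Dec (adj G u t₀ ≡ true) → ∃ λ u₀ → ∃ λ v₀ → Twin u₀ v₀ × (∀ w → IsoK w → Same G T w u₀)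
    choose (yes e) = u , v , tw , λ w′ (w′∈ , iso′) t t∉ →
      trans (isolated-T w′∈ iso′ t t∉) (sym (isolated-constant w∈ iso t₀ t t₀∈T t∉ e))
    choose (no ne) = v , u , twin-sym tw , λ w′ (w′∈ , iso′) t t∉ →
      trans (isolated-T w′∈ iso′ t t∉) (sym (Swapped.isolated-constant w∈ iso t₀ t t₀∈T t∉
        (bool-≢-≢ {b = adj G u t₀} (twin-T tw t₀∈T ∘ sym) (ne ∘ sym))))

m<⇒large : ∀ {n} ρ → m (5 + ρ) < n → 3 + 2 * m (3 + ρ) ≤ n
m<⇒large {n} ρ m<n = subst (_< n) (m-step {3 + ρ} (s≤s (s≤s z≤n))) m<n

theorem4p5 : (n r : ℕ) (G : Graph n) → Reduced G → HasRank G r → 10 ≤ r → m r < n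
    → MinimalCounterexampleOrder n
    → (τ : ℕ) → IsTau G τ
    → (K : Subset n) → ∣ K ∣ ≡ n ∸ τ → HasDup G K
    → (∃ λ rH → RankOn G K rH × r ∸ 3 ≤ rH)
    → (R : Subset n) → Representatives G K R
    → (∀ u → u ∈ K → ¬ IsolatedIn G K u)
    × ((IsoComplete G R 1 × m (r ∸ 2) + 2 ≤ τ)
    ⊎ (IsoComplete G R 2 × m (r ∸ 2) + 1 ≤ τ)
    ⊎ (IsoComplete G R 3 × τ ≡ m (r ∸ 2)))
theorem4p5 n _ G red rank (s≤s (s≤s (s≤s (s≤s (s≤s {n = ρ} 5≤ρ))))) m<n minimal τ isτ K ∣K∣≡ (u , u∈ , v , v∈ , u≢v , same) (rH , rankK , r∸3≤rH) R reps
  with u₀ , v₀ , tw₀ , oriented ← Casework.orientation 5≤ρ G red rank minimal (m<⇒large ρ m<n) isτ K ∣K∣≡ rankK r∸3≤rH (u∈ , v∈ , u≢v , same)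
  = (λ u u∈ iso → O.noIso u (u∈ , iso)) , O.conclusion R reps
  where
  module O = Casework.Conclusion 5≤ρ G red rank minimal (m<⇒large ρ m<n) isτ K ∣K∣≡ rankK r∸3≤rH u₀ v₀ tw₀ oriented
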